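{- There is an absolute constant $C>0$ such that for all sufficiently large $n$, every edge-ordering of the complete graph $K_n$ contains a monotone path of length at least $$\frac{n}{2^{C\sqrt{\log n\,\log\log n}}}.$$ In other words, $f(K_n)\ge n/2^{O(\sqrt{\log n\log\log n})}=n^{1-o(1)}$.
   Context: An edge-ordering of a graph $G$ is a total order $\le_G$ on $E(G)$. A path is monotone if its consecutive edges form a monotone sequence with respect to $\le_G$. The altitude $f(G)$ is the maximum $k$ such that every edge-ordering of $G$ has a monotone path of length $k$ (length = number of edges). All logarithms are base 2. -}

module Defs where

open import Algebra.Definitions.RawSemiring using (_^_)
open import Data.Fin.Base as Fin using (Fin; inject₁)
open import Data.Integer.Base as ℤ using (ℤ; +_; -[1+_])
open import Data.Nat.Base as ℕ using (ℕ)
open import Data.Product.Base using (_×_; ∃)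
open import Data.Rational.Base using (ℚ; 0ℚ; ½; _/_; _*_; _≤_; _<_; ↥_; ↧ₙ_; +-*-rawSemiring)
open import Data.Sum.Base using (_⊎_)
open import Function.Definitions using (Injective)
open import Level using (0ℓ)
open import Relation.Binary.Core using (Rel)
open import Relation.Binary.Definitions using (Symmetric; Monotonic₁; Antitonic₁)
open import Relation.Binary.PropositionalEquality using (_≡_; _≢_; refl; ≢-sym)
open import Relation.Binary.Structures using (IsTotalOrder)
open import Relation.Nullary.Negation using (¬_)
open import Relation.Unary using (Pred; _∈_; _⊆_)

record Graph (n : ℕ) : Set₁ where
  field
    Adj    : Rel (Fin n) 0ℓ
    sym    : Symmetric Adj
    irrefl : ∀ {v} → ¬ Adj v v

K : ∀ n → Graph n
K n = record
  { Adj    = _≢_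
  ; sym    = ≢-sym
  ; irrefl = λ v≢v → v≢v refl
  }

module _ {n : ℕ} (G : Graph n) where
  open Graph G

  -- An undirected edge is an adjacent ordered pair, taken up to _≈ₑ_.
  record Edge : Set where
    constructor edge
    field
      src tgt : Fin n
      adj     : Adj src tgt

  _≈ₑ_ : Rel Edge 0ℓ
  edge u v _ ≈ₑ edge u′ v′ _ = (u ≡ u′ × v ≡ v′) ⊎ (u ≡ v′ × v ≡ u′)

  record EdgeOrdering : Set₁ where
    field
      _≼_          : Rel Edge 0ℓ
      isTotalOrder : IsTotalOrder _≈ₑ_ _≼_

  -- `length` is the number of edges.
  record Path (length : ℕ) : Set where
    field
      vertex   : Fin (ℕ.suc length) → Fin n
      distinct : Injective _≡_ _≡_ vertex
      adjacent : ∀ i → Adj (vertex (inject₁ i)) (vertex (Fin.suc i))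

    edgeAt : Fin length → Edge
    edgeAt i = edge (vertex (inject₁ i)) (vertex (Fin.suc i)) (adjacent i)

  Monotone : EdgeOrdering → ∀ {k} → Path k → Set
  Monotone o p = Monotonic₁ Fin._≤_ _≼_ edgeAt ⊎ Antitonic₁ Fin._≤_ _≼_ edgeAt
    where open EdgeOrdering o
          open Path p

  HasMonotonePath : EdgeOrdering → ℕ → Set
  HasMonotonePath o k = ∃ λ (p : Path k) → Monotone o p

  IsAltitude : ℕ → Set₁
  IsAltitude a = Forced a × (∀ k → Forced k → k ℕ.≤ a)
    where
    Forced : ℕ → Set₁
    Forced k = (o : EdgeOrdering) → HasMonotonePath o k

-- A real x is represented by its open lower cut { q ∈ ℚ ∣ q < x }; comparison
-- of reals is inclusion of cuts.  The empty cut plays the role of -∞.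
Real : Set₁
Real = Pred ℚ 0ℓ

infix  4 _≤ᵣ_
infixl 7 _·_ _÷_

_≤ᵣ_ : Rel Real 0ℓ
x ≤ᵣ y = x ⊆ y

rational : ℚ → Real
rational r q = q < r

natural : ℕ → Real
natural n = rational (+ n / 1)

-- Product of nonnegative reals.
_·_ : Real → Real → Real
(x · y) q = q < 0ℚ ⊎
  ∃ λ r → ∃ λ s → (0ℚ ≤ r × r ∈ x) × (0ℚ ≤ s × s ∈ y) × q ≤ r * s

-- Quotient of positive reals: for q ≥ 0, q < x / y iff q y ≤ p for some
-- rational p < x, and q y is the supremum of the q s with s < y.
_÷_ : Real → Real → Real
(x ÷ y) q = q < 0ℚ ⊎ ∃ λ p → p ∈ x × (∀ s → s ∈ y → q * s ≤ p)

-- Square root of a nonnegative real.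
√ : Real → Real
√ x q = q < 0ℚ ⊎ q * q ∈ x

_^ℚ_ : ℚ → ℕ → ℚ
_^ℚ_ = _^_ +-*-rawSemiring

2^ℤ : ℤ → ℚ
2^ℤ (+ n)    = (+ 2 / 1) ^ℚ n
2^ℤ -[1+ n ] = ½ ^ℚ ℕ.suc n

-- Binary logarithm of a positive real: for q = a / b with b > 0,
-- 2 ^ q ≤ r iff 2 ^ a ≤ r ^ b.
log₂ : Real → Real
log₂ x q = ∃ λ r → (0ℚ < r × r ∈ x) × 2^ℤ (↥ q) ≤ r ^ℚ (↧ₙ q)

-- The real 2 ^ x: for q > 0 and r = a / b with b > 0,
-- q ≤ 2 ^ r iff q ^ b ≤ 2 ^ a.
exp₂ : Real → Real
exp₂ x q = q ≤ 0ℚ ⊎ ∃ λ r → r ∈ x × q ^ℚ (↧ₙ r) ≤ 2^ℤ (↥ r)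

-- C √(log n · log log n)
exponent : ℚ → ℕ → Real
exponent C n = rational C · √ (log₂ (natural n) · log₂ (log₂ (natural n)))

-- n / 2 ^ (C √(log n · log log n))
bound : ℚ → ℕ → Real
bound C n = natural n ÷ exp₂ (exponent C n)

{-# OPTIONS --safe #-}

-- Write an edge-ordering as a system of distinct edge times.  The proof shows by induction
-- on j that a graph of average degree y ^ (j + 1) (log n) ^ O(j) contains an increasing path
-- of length y ^ j; optimising y gives the theorem.  For the induction the path must be robust:
-- it starts after some edge at its first vertex, and it can be chosen to avoid any given set
-- of few vertices.
--
-- Suppose no vertex is robust for length y l after any of its edges.  Assign to an edge uv the
-- largest h such that both ends are robust for length h l after it; then one end, say u,
-- is blocked at level h + 1 by a small set S(u), and on the edges of level h no path of length
-- l from u, starting after the first such edge at u, avoids S(u).  It remains to see that the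
-- edges of one level are few.  Let R(u) be the set of vertices reached from u so far by
-- increasing walks of level h avoiding S(u), order the vertices by priority and call the owner
-- of v the first u with v in R(u).  As owners only improve, for a random order the owner of
-- each v changes O(log n) times.  An edge either changes the owner of an end, or leads into
-- S(u) for the owner u of its other end, or has both ends owned by the same u.  The edges of
-- the last kind, for one u, form a sparse graph by induction: otherwise it contains a
-- robust vertex, and a path from u to this vertex extends to one of length l avoiding S(u).
module Submission where

open import Data.Product.Base using (_×_; _,_; ∃; ∃-syntax; proj₁; proj₂)
open import Data.Sum.Base using (_⊎_; inj₁; inj₂; swap)
open import Function.Base using (_∘_; id)
open import Relation.Binary.PropositionalEquality
open import Relation.Nullary

module Combinatorics where
  import Algebra.Properties.Semiring.Sum
  open import Data.Empty using (⊥)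
  open import Data.Fin.Base as Fin using (Fin; zero; suc; toℕ; fromℕ<; inject₁; punchIn; punchOut)
  open import Data.Fin.Properties as Fin using (any?)
  open import Data.List.Base using (List; []; _∷_; length; _++_; find)
  open import Data.List.Membership.Propositional using (_∈_; _∉_)
  open import Data.List.Membership.Propositional.Properties using (∈-++⁺ˡ; ∈-++⁻)
  import Data.List.Membership.DecPropositional as DecMembership
  open import Data.List.Relation.Unary.Any using (here; there)
  open import Data.Maybe.Base using (Maybe; just)
  import Data.Maybe.Properties as Maybe
  open import Data.Nat.Base
  open import Data.Nat.DivMod using (m≡m%n+[m/n]*n; m%n<n)
  open import Data.Nat.Properties
  open import Data.Nat.Tactic.RingSolver using (solve-∀)
  open import Data.Unit.Base using (⊤; tt)
  open import Defs using (K; edge; EdgeOrdering; module EdgeOrdering; HasMonotonePath)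
  open import Function.Definitions using (Injective)
  open import Relation.Binary.Structures using (IsTotalOrder)
  open import Relation.Nullary.Decidable using (decidable-stable)
  open import Relation.Unary using (Pred; Decidable)
  open Algebra.Properties.Semiring.Sum +-*-semiring
    using (sum; sum-remove; sum-cong-≗; ∑-distrib-+; ∑-comm; *-distribˡ-sum; sum-replicate-zero)

  -- Counting over finite sets

  module _ {n : ℕ} where
    open DecMembership (Fin._≟_ {n}) using (_∈?_) public

  𝟙 : ∀ {P : Set} → Dec P → ℕ
  𝟙 (yes _) = 1
  𝟙 (no _)  = 0

  private variable
    P Q : Set

  𝟙≤1 : (p? : Dec P) → 𝟙 p? ≤ 1
  𝟙≤1 (yes _) = ≤-refl
  𝟙≤1 (no _)  = z≤n

  𝟙-true : (p? : Dec P) → P → 𝟙 p? ≡ 1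
  𝟙-true (yes _) _ = refl
  𝟙-true (no ¬p) p = contradiction p ¬p

  𝟙-false : (p? : Dec P) → ¬ P → 𝟙 p? ≡ 0
  𝟙-false (yes p) ¬p = contradiction p ¬p
  𝟙-false (no _) _   = refl

  𝟙-bound : (p? : Dec P) {k : ℕ} → (P → 1 ≤ k) → 𝟙 p? ≤ k
  𝟙-bound (yes p) f = f p
  𝟙-bound (no _)  f = z≤n

  𝟙≤ : (p? : Dec P) (q? : Dec Q) → (P → Q) → 𝟙 p? ≤ 𝟙 q?
  𝟙≤ p? q? f = 𝟙-bound p? (λ p → ≤-reflexive (sym (𝟙-true q? (f p))))

  sum-mono : ∀ {n} {f g : Fin n → ℕ} → (∀ i → f i ≤ g i) → sum f ≤ sum g
  sum-mono {zero}  f≤g = z≤n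
  sum-mono {suc n} f≤g = +-mono-≤ (f≤g zero) (sum-mono (f≤g ∘ suc))

  sum-mono-< : ∀ {n} {f g : Fin n → ℕ} → (∀ i → f i ≤ g i) → ∀ j → f j < g j → sum f < sum g
  sum-mono-< f≤g zero    f<g = +-mono-<-≤ f<g (sum-mono (f≤g ∘ suc))
  sum-mono-< f≤g (suc j) f<g = +-mono-≤-< (f≤g zero) (sum-mono-< (f≤g ∘ suc) j f<g)

  sum-bounded : ∀ {n} {f : Fin n → ℕ} {k} → (∀ i → f i ≤ k) → sum f ≤ n * k
  sum-bounded {zero}  f≤k = z≤n
  sum-bounded {suc n} f≤k = +-mono-≤ (f≤k zero) (sum-bounded (f≤k ∘ suc))

  sum-const : ∀ n k → sum {n} (λ _ → k) ≡ n * k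
  sum-const zero    k = refl
  sum-const (suc n) k = cong (k +_) (sum-const n k)

  sum-zero : ∀ {n} {f : Fin n → ℕ} → (∀ i → f i ≡ 0) → sum f ≡ 0
  sum-zero {n} f≡0 = trans (sum-cong-≗ f≡0) (sum-replicate-zero n)

  term≤sum : ∀ {n} (f : Fin n → ℕ) i → f i ≤ sum f
  term≤sum f zero    = m≤m+n _ _
  term≤sum f (suc i) = ≤-trans (term≤sum (f ∘ suc) i) (m≤n+m _ (f zero))

  sum-punchIn : ∀ {n} (f : Fin (suc n) → ℕ) i → sum (f ∘ punchIn i) ≤ sum f
  sum-punchIn f i = ≤-trans (m≤n+m _ (f i)) (≤-reflexive (sym (sum-remove {i = i} f)))

  sum-scaled : ∀ {n} {f g : Fin n → ℕ} k → (∀ i → f i ≤ k * g i) → sum f ≤ k * sum g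
  sum-scaled {g = g} k f≤ = ≤-trans (sum-mono f≤) (≤-reflexive (sym (*-distribˡ-sum k g)))

  below-average : ∀ {n} (f : Fin (suc n) → ℕ) k → sum f ≤ suc n * k → ∃[ i ] f i ≤ k
  below-average {n} f k f≤ with any? (λ i → f i ≤? k)
  ... | yes p = p
  ... | no ¬p = contradiction f≤ (<⇒≱ (begin-strict
    suc n * k           <⟨ *-monoʳ-< (suc n) (n<1+n k) ⟩
    suc n * suc k       ≡⟨ sum-const (suc n) (suc k) ⟨
    sum {suc n} (λ _ → suc k) ≤⟨ sum-mono (λ i → ≰⇒> (λ fi≤k → ¬p (i , fi≤k))) ⟩
    sum f               ∎))
    where open ≤-Reasoning

  count-unique : ∀ {n} {P : Pred (Fin n) _} (P? : Decidable P) →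
                 (∀ {i j} → P i → P j → i ≡ j) → sum (λ i → 𝟙 (P? i)) ≤ 1
  count-unique {zero} P? uniq = z≤n
  count-unique {suc n} P? uniq with P? zero
  ... | no _  = count-unique (P? ∘ suc) (λ p q → Fin.suc-injective (uniq p q))
  ... | yes p = ≤-reflexive (cong suc (sum-zero (λ i → 𝟙-false (P? (suc i)) (λ q → Fin.0≢1+n (uniq p q)))))

  count-∈ : ∀ {n} (xs : List (Fin n)) → sum (λ i → 𝟙 (i ∈? xs)) ≤ length xs
  count-∈ {n} []   = ≤-reflexive (sum-zero {n} {λ _ → 0} (λ _ → refl))
  count-∈ (x ∷ xs) = begin
    sum (λ i → 𝟙 (i ∈? (x ∷ xs)))                    ≤⟨ sum-mono split ⟩
    sum (λ i → 𝟙 (i Fin.≟ x) + 𝟙 (i ∈? xs))           ≡⟨ ∑-distrib-+ (λ i → 𝟙 (i Fin.≟ x)) (λ i → 𝟙 (i ∈? xs)) ⟩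
    sum (λ i → 𝟙 (i Fin.≟ x)) + sum (λ i → 𝟙 (i ∈? xs)) ≤⟨ +-mono-≤ (count-unique (Fin._≟ x) (λ p q → trans p (sym q))) (count-∈ xs) ⟩
    suc (length xs) ∎
    where
    open ≤-Reasoning
    split : ∀ i → 𝟙 (i ∈? (x ∷ xs)) ≤ 𝟙 (i Fin.≟ x) + 𝟙 (i ∈? xs)
    split i = 𝟙-bound (i ∈? (x ∷ xs)) λ where
      (here p)  → ≤-trans (≤-reflexive (sym (𝟙-true (i Fin.≟ x) p))) (m≤m+n _ _)
      (there p) → ≤-trans (≤-reflexive (sym (𝟙-true (i ∈? xs) p))) (m≤n+m _ (𝟙 (i Fin.≟ x)))

  many⇒∉ : ∀ {n} {P : Pred (Fin n) _} (P? : Decidable P) (xs : List (Fin n)) →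
           length xs < sum (λ i → 𝟙 (P? i)) → ∃[ i ] P i × i ∉ xs
  many⇒∉ P? xs len< with any? (λ i → P? i ×-dec ¬? (i ∈? xs))
  ... | yes p = p
  ... | no ¬p = contradiction (≤-trans (sum-mono λ i → 𝟙≤ (P? i) (i ∈? xs) (inxs i)) (count-∈ xs)) (<⇒≱ len<)
    where
    inxs : ∀ i → _ → i ∈ xs
    inxs i Pi with i ∈? xs
    ... | yes q = q
    ... | no ¬q = contradiction (i , Pi , ¬q) ¬p

  -- Sums over initial segments of the naturals

  ∑< : ℕ → (ℕ → ℕ) → ℕ
  ∑< zero    f = 0
  ∑< (suc m) f = ∑< m f + f m

  ∑<-mono : ∀ m {f g : ℕ → ℕ} → (∀ i → i < m → f i ≤ g i) → ∑< m f ≤ ∑< m g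
  ∑<-mono zero    f≤g = z≤n
  ∑<-mono (suc m) f≤g = +-mono-≤ (∑<-mono m (λ i i<m → f≤g i (m≤n⇒m≤1+n i<m))) (f≤g m ≤-refl)

  term≤∑< : ∀ m (f : ℕ → ℕ) {i} → i < m → f i ≤ ∑< m f
  term≤∑< (suc m) f {i} (s≤s i≤m) with m≤n⇒m<n∨m≡n i≤m
  ... | inj₁ i<m  = ≤-trans (term≤∑< m f i<m) (m≤m+n _ _)
  ... | inj₂ refl = m≤n+m _ _

  sum-∑<-comm : ∀ {n} m (f : Fin n → ℕ → ℕ) → sum (λ i → ∑< m (f i)) ≡ ∑< m (λ s → sum (λ i → f i s))
  sum-∑<-comm {n} zero f = sum-zero {n} {λ _ → 0} (λ _ → refl)
  sum-∑<-comm (suc m) f = trans (∑-distrib-+ (λ i → ∑< m (f i)) (λ i → f i m)) (cong (_+ sum (λ i → f i m)) (sum-∑<-comm m f))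

  -- Distinct elements satisfying P have distinct times, so the sum over them is a
  -- partial sum of f.
  sum-reindex : ∀ {n} {P : Pred (Fin n) _} (P? : Decidable P) (time : Fin n → ℕ) T (f : ℕ → ℕ) →
                (∀ i → time i < T) → (∀ {i j} → P i → P j → time i ≡ time j → i ≡ j) →
                sum (λ i → 𝟙 (P? i) * f (time i)) ≤ ∑< T f
  sum-reindex {P = P} P? time T f time<T inj = begin
    sum (λ i → 𝟙 (P? i) * f (time i))
      ≤⟨ sum-mono (λ i → ≤-trans (at i) (term≤∑< T (λ s → f s * 𝟙 (at? s i)) (time<T i))) ⟩
    sum (λ i → ∑< T (λ s → f s * 𝟙 (at? s i)))
      ≡⟨ sum-∑<-comm T (λ i s → f s * 𝟙 (at? s i)) ⟩
    ∑< T (λ s → sum (λ i → f s * 𝟙 (at? s i)))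
      ≤⟨ ∑<-mono T (λ s _ → ≤-trans (≤-reflexive (sym (*-distribˡ-sum (f s) (λ i → 𝟙 (at? s i)))))
                            (≤-trans (*-monoʳ-≤ (f s) (count-unique (at? s) λ (p , e) (q , e′) → inj p q (trans e (sym e′))))
                                     (≤-reflexive (*-identityʳ (f s))))) ⟩
    ∑< T f ∎
    where
    open ≤-Reasoning
    at? : ∀ s → Decidable (λ i → P i × time i ≡ s)
    at? s i = P? i ×-dec (time i ≟ s)
    at : ∀ i → 𝟙 (P? i) * f (time i) ≤ f (time i) * 𝟙 (at? (time i) i)
    at i = ≤-trans (≤-reflexive (*-comm (𝟙 (P? i)) _)) (*-monoʳ-≤ (f (time i)) (𝟙≤ (P? i) (at? (time i) i) (_, refl)))

  -- Records of a random ordering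

  bitlength : ℕ → ℕ
  bitlength zero = 0
  bitlength (suc c) with suc c ≟ 2 ^ bitlength c
  ... | yes _ = suc (bitlength c)
  ... | no _  = bitlength c

  <2^bitlength : ∀ c → c < 2 ^ bitlength c
  <2^bitlength zero = ≤-refl
  <2^bitlength (suc c) with suc c ≟ 2 ^ bitlength c
  ... | yes eq = ≤-trans (s≤s (≤-reflexive eq)) (^-monoʳ-< 2 (s≤s (s≤s z≤n)) (n<1+n (bitlength c)))
  ... | no neq = ≤∧≢⇒< (<2^bitlength c) neq

  bitlength-suc : ∀ c → bitlength c ≤ bitlength (suc c)
  bitlength-suc c with suc c ≟ 2 ^ bitlength c
  ... | yes _ = n≤1+n _
  ... | no _  = ≤-refl

  -- Bounds the expected number of left-to-right minima of a random ordering of c elements.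
  records : ℕ → ℕ
  records c = 2 * bitlength c

  records-mono : ∀ {c d} → c ≤ d → records c ≤ records d
  records-mono c≤d = go (≤⇒≤′ c≤d)
    where
    go : ∀ {c d} → c ≤′ d → records c ≤ records d
    go (≤′-reflexive refl) = ≤-refl
    go (≤′-step {n = d} c≤′d) = ≤-trans (go c≤′d) (*-monoʳ-≤ 2 (bitlength-suc d))

  -- If the element of highest priority is the (j + 1)-st to arrive, it makes one change, no change
  -- follows, and the j earlier arrivals make `records j` on average. Dividing the sum over j by c
  -- gives the recursion for the expected number of records.
  recordSum : ℕ → ℕ
  recordSum c = ∑< c (λ j → suc (records j))

  -- Elements that arrive together after c others pay `suc (records c)` each; arriving one by one
  -- they would pay no less.
  recordSum-step : ∀ c d → recordSum c + d * suc (records c) ≤ recordSum (d + c)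
  recordSum-step c zero    = ≤-reflexive (+-identityʳ _)
  recordSum-step c (suc d) = begin
    recordSum c + suc d * suc (records c)                   ≡⟨ lem (recordSum c) (suc (records c)) (d * suc (records c)) ⟩
    (recordSum c + d * suc (records c)) + suc (records c)   ≤⟨ +-mono-≤ (recordSum-step c d) (s≤s (records-mono (m≤n+m c d))) ⟩
    recordSum (d + c) + suc (records (d + c)) ∎
    where
    open ≤-Reasoning
    lem : ∀ a b c → a + (b + c) ≡ a + c + b
    lem = solve-∀

  -- Between powers of 2 a plain induction loses 1 per step. The `invariant` therefore allows an
  -- excess of `suc c` and carries `2 ^ bitlength` on the left; at a power of 2 this term doubles,
  -- and the rise of `records` by 2, multiplied by c, pays for it. Cancelling `suc c` by
  -- `<2^bitlength` returns the plain bound.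
  recordSum-bound : ∀ c → recordSum c ≤ c * records c
  recordSum-bound zero    = z≤n
  recordSum-bound (suc c) = +-cancelʳ-≤ (suc c) (recordSum (suc c)) (suc c * records (suc c))
    (≤-trans (+-monoʳ-≤ (recordSum (suc c)) (<⇒≤ (<2^bitlength (suc c)))) (invariant c))
    where
    open ≤-Reasoning
    same : ∀ p c b x → p + x ≤ suc c * (2 * b) + suc c →
           (p + suc (2 * b)) + x ≤ suc (suc c) * (2 * b) + suc (suc c)
    same p c b x le = begin
      (p + suc (2 * b)) + x               ≡⟨ l₁ p b x ⟩
      (p + x) + suc (2 * b)               ≤⟨ +-monoˡ-≤ _ le ⟩
      suc c * (2 * b) + suc c + suc (2 * b) ≡⟨ l₂ c b ⟩
      suc (suc c) * (2 * b) + suc (suc c) ∎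
      where
      l₁ : ∀ p b x → (p + suc (2 * b)) + x ≡ (p + x) + suc (2 * b)
      l₁ = solve-∀
      l₂ : ∀ c b → suc c * (2 * b) + suc c + suc (2 * b) ≡ suc (suc c) * (2 * b) + suc (suc c)
      l₂ = solve-∀
    jump : ∀ p c b x → suc (suc c) ≡ x → p + x ≤ suc c * (2 * b) + suc c →
           (p + suc (2 * b)) + 2 * x ≤ suc (suc c) * (2 * suc b) + suc (suc c)
    jump p c b _ refl le = begin
      (p + suc (2 * b)) + 2 * suc (suc c)                    ≡⟨ l₁ p b c ⟩
      (p + suc (suc c)) + (suc (2 * b) + suc (suc c))         ≤⟨ +-monoˡ-≤ _ le ⟩
      suc c * (2 * b) + suc c + (suc (2 * b) + suc (suc c))  ≤⟨ m≤m+n _ (suc (suc c)) ⟩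
      suc c * (2 * b) + suc c + (suc (2 * b) + suc (suc c)) + suc (suc c) ≡⟨ l₂ c b ⟩
      suc (suc c) * (2 * suc b) + suc (suc c) ∎
      where
      l₁ : ∀ p b c → (p + suc (2 * b)) + 2 * suc (suc c) ≡ (p + suc (suc c)) + (suc (2 * b) + suc (suc c))
      l₁ = solve-∀
      l₂ : ∀ c b → suc c * (2 * b) + suc c + (suc (2 * b) + suc (suc c)) + suc (suc c) ≡ suc (suc c) * (2 * suc b) + suc (suc c)
      l₂ = solve-∀
    invariant : ∀ c → recordSum (suc c) + 2 ^ bitlength (suc c) ≤ suc c * records (suc c) + suc c
    invariant zero = ≤-refl
    invariant (suc c) with invariant c
    ... | ih with suc (suc c) ≟ 2 ^ bitlength (suc c)
    ...   | yes eq = jump (recordSum (suc c)) c (bitlength (suc c)) _ eq ih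
    ...   | no _   = same (recordSum (suc c)) c (bitlength (suc c)) _ ih

  -- First matches in a priority list

  find-∷-yes : ∀ {A : Set} {P : A → Set} (P? : Decidable P) x xs → P x → find P? (x ∷ xs) ≡ just x
  find-∷-yes P? x xs Px with P? x
  ... | yes _  = refl
  ... | no ¬Px = contradiction Px ¬Px

  find-sound : ∀ {A : Set} {P : A → Set} (P? : Decidable P) xs {x} → find P? xs ≡ just x → P x
  find-sound P? (x ∷ xs) eq with P? x
  find-sound P? (x ∷ xs) refl | yes Px = Px
  find-sound P? (x ∷ xs) eq   | no _   = find-sound P? xs eq

  find-complete : ∀ {A : Set} {P : A → Set} (P? : Decidable P) {xs x} → x ∈ xs → P x → ∃[ y ] find P? xs ≡ just y
  find-complete P? {x ∷ xs} x∈ Px with P? x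
  find-complete P? {x ∷ xs} x∈          Px | yes _  = x , refl
  find-complete P? {x ∷ xs} (here refl) Px | no ¬Px = contradiction Px ¬Px
  find-complete P? {x ∷ xs} (there x∈)  Px | no _   = find-complete P? x∈ Px

  -- Each of x and y satisfies both predicates, so neither precedes the other. This identifies the
  -- owners of two adjacent vertices.
  find-antisym : ∀ {A : Set} {P Q : A → Set} (P? : Decidable P) (Q? : Decidable Q) xs {x y} →
                 find P? xs ≡ just x → find Q? xs ≡ just y → Q x → P y → x ≡ y
  find-antisym P? Q? (a ∷ xs) eq₁ eq₂ Qx Py with P? a | Q? a
  find-antisym P? Q? (a ∷ xs) refl refl Qx Py | yes _  | yes _  = refl
  find-antisym P? Q? (a ∷ xs) refl eq₂  Qx Py | yes _  | no ¬Qa = contradiction Qx ¬Qa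
  find-antisym P? Q? (a ∷ xs) eq₁  refl Qx Py | no ¬Pa | yes _  = contradiction Py ¬Pa
  find-antisym P? Q? (a ∷ xs) eq₁  eq₂  Qx Py | no _   | no _   = find-antisym P? Q? xs eq₁ eq₂ Qx Py

  -- Changes of owner along a growing family of sets

  module Chain {n : ℕ} (X : ℕ → Fin n → Set) (X? : ∀ s → Decidable (X s))
               (X-suc : ∀ {s v} → X s v → X (suc s) v) (X-empty : ∀ {v} → ¬ X 0 v) where

    owner : List (Fin n) → ℕ → Maybe (Fin n)
    owner pl s = find (X? s) pl

    change? : ∀ pl s → Dec (owner pl s ≢ owner pl (suc s))
    change? pl s = ¬? (Maybe.≡-dec Fin._≟_ (owner pl s) (owner pl (suc s)))

    changes : List (Fin n) → ℕ → ℕ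
    changes pl m = ∑< m (λ s → 𝟙 (change? pl s))

    present : ∀ {k} → (Fin k → Fin n) → ℕ → ℕ
    present L m = sum (λ i → 𝟙 (X? m (L i)))

    -- The last time up to m at which x is absent: presence persists by `X-suc`, and nothing is
    -- present at time 0.
    before : Fin n → ℕ → ℕ
    before x zero = zero
    before x (suc m) with X? (suc m) x
    ... | yes _ = before x m
    ... | no _  = suc m

    before-absent : ∀ {x} m → ¬ X m x → before x m ≡ m
    before-absent zero ¬X = refl
    before-absent {x} (suc m) ¬X with X? (suc m) x
    ... | yes p = contradiction p ¬X
    ... | no _  = refl

    before-present : ∀ {x} m → X (suc m) x → before x (suc m) ≡ before x m
    before-present {x} m p with X? (suc m) x
    ... | yes _ = refl
    ... | no ¬p = contradiction p ¬p

    absent-pred : ∀ {s v} → ¬ X (suc s) v → ¬ X s v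
    absent-pred ¬p p = ¬p (X-suc p)

    changes-absent : ∀ {x} pl m → ¬ X m x → changes (x ∷ pl) m ≡ changes pl m
    changes-absent pl zero ¬p = refl
    changes-absent {x} pl (suc m) ¬p = cong₂ _+_ (changes-absent pl m (absent-pred ¬p)) same
      where
      same : 𝟙 (change? (x ∷ pl) m) ≡ 𝟙 (change? pl m)
      same with X? m x | X? (suc m) x
      ... | yes q | _     = contradiction (X-suc q) ¬p
      ... | no _  | yes q = contradiction q ¬p
      ... | no _  | no _  = refl

    -- Once present, x at the head of the list is the owner for good. Its arrival makes at most one
    -- change, and earlier the list behaves as if x were missing.
    changes-∷ : ∀ x pl m → changes (x ∷ pl) m ≤ 𝟙 (X? m x) + changes pl (before x m)
    changes-∷ x pl zero = z≤n
    changes-∷ x pl (suc m) = by-cases (X? m x) (X? (suc m) x)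
      where
      open ≤-Reasoning
      by-cases : Dec (X m x) → Dec (X (suc m) x) →
                 changes (x ∷ pl) (suc m) ≤ 𝟙 (X? (suc m) x) + changes pl (before x (suc m))
      by-cases _ (no ¬q) = begin
        changes (x ∷ pl) (suc m)            ≡⟨ changes-absent pl (suc m) ¬q ⟩
        changes pl (suc m)                  ≡⟨ cong (changes pl) (before-absent (suc m) ¬q) ⟨
        changes pl (before x (suc m))       ≤⟨ m≤n+m _ _ ⟩
        𝟙 (X? (suc m) x) + changes pl (before x (suc m)) ∎
      by-cases (yes p) (yes q) = begin
        changes (x ∷ pl) m + 𝟙 (change? (x ∷ pl) m) ≡⟨ cong (changes (x ∷ pl) m +_) (𝟙-false (change? (x ∷ pl) m) unchanged) ⟩
        changes (x ∷ pl) m + 0                        ≡⟨ +-identityʳ _ ⟩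
        changes (x ∷ pl) m                            ≤⟨ changes-∷ x pl m ⟩
        𝟙 (X? m x) + changes pl (before x m)
          ≡⟨ cong₂ _+_ (trans (𝟙-true (X? m x) p) (sym (𝟙-true (X? (suc m) x) q))) (cong (changes pl) (sym (before-present m q))) ⟩
        𝟙 (X? (suc m) x) + changes pl (before x (suc m)) ∎
        where
        unchanged : ¬ (owner (x ∷ pl) m ≢ owner (x ∷ pl) (suc m))
        unchanged c = c (trans (find-∷-yes (X? m) x pl p) (sym (find-∷-yes (X? (suc m)) x pl q)))
      by-cases (no ¬p) (yes q) = begin
        changes (x ∷ pl) m + 𝟙 (change? (x ∷ pl) m) ≤⟨ +-monoʳ-≤ _ (𝟙≤1 (change? (x ∷ pl) m)) ⟩
        changes (x ∷ pl) m + 1                        ≡⟨ +-comm _ 1 ⟩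
        1 + changes (x ∷ pl) m
          ≡⟨ cong₂ _+_ (sym (𝟙-true (X? (suc m) x) q))
               (trans (changes-absent pl m ¬p) (cong (changes pl) (sym (trans (before-present m q) (before-absent m ¬p))))) ⟩
        𝟙 (X? (suc m) x) + changes pl (before x (suc m)) ∎

    -- Averaging over the choice of x as element of highest priority.
    module _ {k : ℕ} (L : Fin k → Fin n) where
      open ≤-Reasoning

      private
        weight : ℕ → Fin n → ℕ
        weight m x = 𝟙 (X? m x) * suc (records (present L (before x m)))

        arrives? : ∀ m i → Dec (¬ X m (L i) × X (suc m) (L i))
        arrives? m i = ¬? (X? m (L i)) ×-dec X? (suc m) (L i)

        arrivals : ℕ → ℕ
        arrivals m = sum (λ i → 𝟙 (arrives? m i))

        present-suc : ∀ m → arrivals m + present L m ≤ present L (suc m)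
        present-suc m = begin
          arrivals m + present L m ≡⟨ ∑-distrib-+ (λ i → 𝟙 (arrives? m i)) (λ i → 𝟙 (X? m (L i))) ⟨
          sum (λ i → 𝟙 (arrives? m i) + 𝟙 (X? m (L i))) ≤⟨ sum-mono pointwise ⟩
          present L (suc m) ∎
          where
          pointwise : ∀ i → 𝟙 (arrives? m i) + 𝟙 (X? m (L i)) ≤ 𝟙 (X? (suc m) (L i))
          pointwise i with X? m (L i) | X? (suc m) (L i)
          ... | yes p | yes q = ≤-refl
          ... | yes p | no ¬q = contradiction (X-suc p) ¬q
          ... | no ¬p | yes q = ≤-refl
          ... | no ¬p | no ¬q = z≤n

        weight-suc : ∀ m i → weight (suc m) (L i) ≤ weight m (L i) + suc (records (present L m)) * 𝟙 (arrives? m i)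
        weight-suc m i = by-cases (X? m (L i)) (X? (suc m) (L i))
          where
          by-cases : Dec (X m (L i)) → Dec (X (suc m) (L i)) →
                     weight (suc m) (L i) ≤ weight m (L i) + suc (records (present L m)) * 𝟙 (arrives? m i)
          by-cases _ (no ¬q) = ≤-trans (≤-reflexive (cong (_* suc (records (present L (before (L i) (suc m))))) (𝟙-false (X? (suc m) (L i)) ¬q))) z≤n
          by-cases (yes p) (yes q) = ≤-trans (≤-reflexive (cong₂ _*_
            (trans (𝟙-true (X? (suc m) (L i)) q) (sym (𝟙-true (X? m (L i)) p)))
            (cong (λ j → suc (records (present L j))) (before-present m q)))) (m≤m+n _ _)
          by-cases (no ¬p) (yes q) = ≤-trans (≤-reflexive (trans (cong₂ _*_ (trans (𝟙-true (X? (suc m) (L i)) q) (sym (𝟙-true (arrives? m i) (¬p , q))))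
            (cong (λ j → suc (records (present L j))) (trans (before-present m q) (before-absent m ¬p)))) (*-comm (𝟙 (arrives? m i)) _))) (m≤n+m _ (weight m (L i)))

        weights : ∀ m → sum (λ i → weight m (L i)) ≤ recordSum (present L m)
        weights zero = ≤-trans (≤-reflexive (sum-zero λ i → cong (_* suc (records (present L 0))) (𝟙-false (X? 0 (L i)) X-empty))) z≤n
        weights (suc m) = begin
          sum (λ i → weight (suc m) (L i))
            ≤⟨ sum-mono (weight-suc m) ⟩
          sum (λ i → weight m (L i) + suc (records (present L m)) * 𝟙 (arrives? m i))
            ≡⟨ ∑-distrib-+ (λ i → weight m (L i)) (λ i → suc (records (present L m)) * 𝟙 (arrives? m i)) ⟩
          sum (λ i → weight m (L i)) + sum (λ i → suc (records (present L m)) * 𝟙 (arrives? m i))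
            ≡⟨ cong (sum (λ i → weight m (L i)) +_) (*-distribˡ-sum (suc (records (present L m))) (λ i → 𝟙 (arrives? m i))) ⟨
          sum (λ i → weight m (L i)) + suc (records (present L m)) * arrivals m
            ≤⟨ +-mono-≤ (weights m) (≤-reflexive (*-comm _ (arrivals m))) ⟩
          recordSum (present L m) + arrivals m * suc (records (present L m))
            ≤⟨ recordSum-step (present L m) (arrivals m) ⟩
          recordSum (arrivals m + present L m)
            ≤⟨ recordSum-mono (present-suc m) ⟩
          recordSum (present L (suc m)) ∎
          where
          recordSum-mono : ∀ {c d} → c ≤ d → recordSum c ≤ recordSum d
          recordSum-mono {c} {d} c≤d = begin
            recordSum c ≤⟨ m≤m+n _ _ ⟩
            recordSum c + (d ∸ c) * suc (records c) ≤⟨ recordSum-step c (d ∸ c) ⟩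
            recordSum (d ∸ c + c) ≡⟨ cong recordSum (m∸n+n≡m c≤d) ⟩
            recordSum d ∎

      -- Present elements contribute at most `recordSum` of their number, hence
      -- `records (present L m)` each on average. For an absent one `before` is m, so it contributes
      -- exactly that much.
      first-choice : ∀ m → sum (λ i → 𝟙 (X? m (L i)) + records (present L (before (L i) m))) ≤ k * records (present L m)
      first-choice m = begin
        sum (λ i → 𝟙 (X? m (L i)) + records (present L (before (L i) m)))
          ≤⟨ sum-mono pointwise ⟩
        sum (λ i → weight m (L i) + r * 𝟙 (¬? (X? m (L i))))
          ≡⟨ ∑-distrib-+ (λ i → weight m (L i)) (λ i → r * 𝟙 (¬? (X? m (L i)))) ⟩
        sum (λ i → weight m (L i)) + sum (λ i → r * 𝟙 (¬? (X? m (L i))))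
          ≤⟨ +-mono-≤ (≤-trans (weights m) (recordSum-bound (present L m)))
                      (≤-reflexive (trans (sym (*-distribˡ-sum r (λ i → 𝟙 (¬? (X? m (L i)))))) (*-comm r _))) ⟩
        present L m * r + absent * r
          ≡⟨ *-distribʳ-+ r (present L m) absent ⟨
        (present L m + absent) * r
          ≡⟨ cong (_* r) total ⟩
        k * r ∎
        where
        r absent : ℕ
        r = records (present L m)
        absent = sum (λ i → 𝟙 (¬? (X? m (L i))))
        pointwise : ∀ i → 𝟙 (X? m (L i)) + records (present L (before (L i) m)) ≤ weight m (L i) + r * 𝟙 (¬? (X? m (L i)))
        pointwise i = by-cases (X? m (L i))
          where
          by-cases : Dec (X m (L i)) → 𝟙 (X? m (L i)) + records (present L (before (L i) m)) ≤ weight m (L i) + r * 𝟙 (¬? (X? m (L i)))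
          by-cases (yes p) rewrite 𝟙-true (X? m (L i)) p = ≤-trans (m≤m+n _ 0) (m≤m+n _ _)
          by-cases (no ¬p) = ≤-trans (≤-reflexive (cong₂ _+_ (𝟙-false (X? m (L i)) ¬p)
            (trans (cong (λ j → records (present L j)) (before-absent m ¬p)) (sym (trans (cong (r *_) (𝟙-true (¬? (X? m (L i))) ¬p)) (*-identityʳ r)))))) (m≤n+m _ (weight m (L i)))
        total : present L m + absent ≡ k
        total = trans (sym (∑-distrib-+ (λ i → 𝟙 (X? m (L i))) (λ i → 𝟙 (¬? (X? m (L i))))))
                (trans (sum-cong-≗ one) (trans (sum-const k 1) (*-identityʳ k)))
          where
          one : ∀ i → 𝟙 (X? m (L i)) + 𝟙 (¬? (X? m (L i))) ≡ 1
          one i with X? m (L i)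
          ... | yes _ = refl
          ... | no _  = refl

    -- There is no owner at time 0, so some change makes v the owner. Hence the number of changes
    -- bounds the number of owners.
    owned-once : ∀ pl m (v : Fin n) → ∀ {s} → s ≤ m → owner pl s ≡ just v →
                 1 ≤ ∑< m (λ s → 𝟙 (change? pl s) * 𝟙 (Maybe.≡-dec Fin._≟_ (owner pl (suc s)) (just v)))
    owned-once pl zero v z≤n eq = contradiction (find-sound (X? 0) pl eq) X-empty
    owned-once pl (suc m) v {s} s≤ eq with Maybe.≡-dec Fin._≟_ (owner pl m) (just v) | m≤n⇒m<n∨m≡n s≤
    ... | yes o | _              = ≤-trans (owned-once pl m v ≤-refl o) (m≤m+n _ _)
    ... | no _  | inj₁ (s≤s s≤m) = ≤-trans (owned-once pl m v s≤m eq) (m≤m+n _ _)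
    ... | no ¬o | inj₂ refl = ≤-trans (≤-reflexive (sym (cong₂ _*_
            (𝟙-true (change? pl m) (λ e → ¬o (trans e eq)))
            (𝟙-true (Maybe.≡-dec Fin._≟_ (owner pl (suc m)) (just v)) eq)))) (m≤n+m _ _)

    ever-owner? : ∀ pl m v → Dec (∃[ s ] s < suc m × owner pl s ≡ just v)
    ever-owner? pl m v = anyUpTo? (λ s → Maybe.≡-dec Fin._≟_ (owner pl s) (just v)) (suc m)

    owners≤changes : ∀ pl m → sum (λ v → 𝟙 (ever-owner? pl m v)) ≤ changes pl m
    owners≤changes pl m = begin
      sum (λ v → 𝟙 (ever-owner? pl m v))
        ≤⟨ sum-mono (λ v → 𝟙-bound (ever-owner? pl m v) (λ (s , s<1+m , eq) → owned-once pl m v (s≤s⁻¹ s<1+m) eq)) ⟩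
      sum (λ v → ∑< m (λ s → 𝟙 (change? pl s) * 𝟙 (is? s v)))
        ≡⟨ sum-∑<-comm m (λ v s → 𝟙 (change? pl s) * 𝟙 (is? s v)) ⟩
      ∑< m (λ s → sum (λ v → 𝟙 (change? pl s) * 𝟙 (is? s v)))
        ≤⟨ ∑<-mono m (λ s _ → ≤-trans (≤-reflexive (sym (*-distribˡ-sum (𝟙 (change? pl s)) (λ v → 𝟙 (is? s v)))))
             (≤-trans (*-monoʳ-≤ (𝟙 (change? pl s)) (count-unique (is? s) (λ p q → Maybe.just-injective (trans (sym p) q))))
                      (≤-reflexive (*-identityʳ _)))) ⟩
      changes pl m ∎
      where
      open ≤-Reasoning
      is? : ∀ s v → Dec (owner pl (suc s) ≡ just v)
      is? s v = Maybe.≡-dec Fin._≟_ (owner pl (suc s)) (just v)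

  module _ {n k : ℕ} (X : Fin k → ℕ → Fin n → Set) (X? : ∀ u s → Decidable (X u s))
           (X-suc : ∀ {u s v} → X u s v → X u (suc s) v) (X-empty : ∀ {u v} → ¬ X u 0 v) where

    private module C (u : Fin k) = Chain (X u) (X? u) X-suc X-empty

    -- One list must serve all chains u at once. Conditional expectations replace the random order:
    -- some head of the list costs at most the average, and the tail is chosen recursively. Each
    -- chain then matters only until the head arrives, which is why the horizon m depends on u.
    few-changes : ∀ {l} (L : Fin l → Fin n) (m : Fin k → ℕ) →
      ∃[ pl ] (∀ i → L i ∈ pl) × sum (λ u → C.changes u pl (m u)) ≤ sum (λ u → records (C.present u L (m u)))
    few-changes {zero} L m = [] , (λ ()) , sum-mono (λ u → ≤-trans (≤-reflexive (none u (m u))) z≤n)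
      where
      none : ∀ u m → C.changes u [] m ≡ 0
      none u zero = refl
      none u (suc m) = trans (+-identityʳ _) (none u m)
    few-changes {suc l} L m with below-average cost (sum (λ u → records (C.present u L (m u)))) averaged
      where
      open ≤-Reasoning
      cost : Fin (suc l) → ℕ
      cost i = sum (λ u → 𝟙 (X? u (m u) (L i)) + records (C.present u L (C.before u (L i) (m u))))
      averaged : sum cost ≤ suc l * sum (λ u → records (C.present u L (m u)))
      averaged = begin
        sum cost
          ≡⟨ ∑-comm (λ i u → 𝟙 (X? u (m u) (L i)) + records (C.present u L (C.before u (L i) (m u)))) ⟩
        sum (λ u → sum (λ i → 𝟙 (X? u (m u) (L i)) + records (C.present u L (C.before u (L i) (m u)))))
          ≤⟨ sum-mono (λ u → C.first-choice u L (m u)) ⟩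
        sum (λ u → suc l * records (C.present u L (m u)))
          ≡⟨ *-distribˡ-sum (suc l) (λ u → records (C.present u L (m u))) ⟨
        suc l * sum (λ u → records (C.present u L (m u))) ∎
    ... | i , cost≤ with few-changes (L ∘ punchIn i) (λ u → C.before u (L i) (m u))
    ...   | pl , all∈ , le = L i ∷ pl , covers , bound
      where
      open ≤-Reasoning
      covers : ∀ j → L j ∈ L i ∷ pl
      covers j with i Fin.≟ j
      ... | yes refl = here refl
      ... | no i≢j   = there (subst (λ j → L j ∈ pl) (Fin.punchIn-punchOut i≢j) (all∈ (punchOut i≢j)))
      bound : sum (λ u → C.changes u (L i ∷ pl) (m u)) ≤ sum (λ u → records (C.present u L (m u)))
      bound = begin
        sum (λ u → C.changes u (L i ∷ pl) (m u))
          ≤⟨ sum-mono (λ u → C.changes-∷ u (L i) pl (m u)) ⟩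
        sum (λ u → 𝟙 (X? u (m u) (L i)) + C.changes u pl (C.before u (L i) (m u)))
          ≡⟨ ∑-distrib-+ (λ u → 𝟙 (X? u (m u) (L i))) (λ u → C.changes u pl (C.before u (L i) (m u))) ⟩
        sum (λ u → 𝟙 (X? u (m u) (L i))) + sum (λ u → C.changes u pl (C.before u (L i) (m u)))
          ≤⟨ +-monoʳ-≤ (sum (λ u → 𝟙 (X? u (m u) (L i)))) (≤-trans le (sum-mono (λ u → records-mono (sum-punchIn (λ j → 𝟙 (X? u (C.before u (L i) (m u)) (L j))) i)))) ⟩
        sum (λ u → 𝟙 (X? u (m u) (L i))) + sum (λ u → records (C.present u L (C.before u (L i) (m u))))
          ≡⟨ ∑-distrib-+ (λ u → 𝟙 (X? u (m u) (L i))) (λ u → records (C.present u L (C.before u (L i) (m u)))) ⟨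
        sum (λ u → 𝟙 (X? u (m u) (L i)) + records (C.present u L (C.before u (L i) (m u))))
          ≤⟨ cost≤ ⟩
        sum (λ u → records (C.present u L (m u))) ∎

  -- Increasing paths in a graph with distinct edge times

  minimal : ∀ {n} {P : Fin n → Set} (P? : Decidable P) (f : Fin n → ℕ) →
            (∃[ i ] P i × (∀ j → P j → f i ≤ f j)) ⊎ (∀ i → ¬ P i)
  minimal {zero} P? f = inj₂ λ ()
  minimal {suc n} P? f with P? zero | minimal (P? ∘ suc) (f ∘ suc)
  ... | no ¬p | inj₂ none = inj₂ λ { zero → ¬p ; (suc i) → none i }
  ... | no ¬p | inj₁ (i , Pi , least) = inj₁ (suc i , Pi , λ { zero p → contradiction p ¬p ; (suc j) → least j })
  ... | yes p | inj₂ none = inj₁ (zero , p , λ { zero _ → ≤-refl ; (suc j) q → contradiction q (none j) })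
  ... | yes p | inj₁ (i , Pi , least) with ≤-total (f zero) (f (suc i))
  ...   | inj₁ f₀≤ = inj₁ (zero , p , λ { zero _ → ≤-refl ; (suc j) q → ≤-trans f₀≤ (least j q) })
  ...   | inj₂ ≤f₀ = inj₁ (suc i , Pi , λ { zero _ → ≤f₀ ; (suc j) q → least j q })

  -- Robustness quantifies over all small sets and is not decided directly; this lets finitely many
  -- instances be assumed decided while proving a decidable goal.
  ¬¬-∀ : ∀ {n} {P : Fin n → Set} → (∀ i → ¬ ¬ P i) → ¬ ¬ (∀ i → P i)
  ¬¬-∀ {zero}  _   k = k λ ()
  ¬¬-∀ {suc n} ¬¬P k = ¬¬P zero λ p → ¬¬-∀ (¬¬P ∘ suc) λ ps → k λ { zero → p ; (suc i) → ps i }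

  module _ {n : ℕ} where

    card : {U : Fin n → Set} → Decidable U → ℕ
    card U? = sum (λ u → 𝟙 (U? u))

    ∑∑ : (Fin n → Fin n → ℕ) → ℕ
    ∑∑ f = sum (λ u → sum (λ v → f u v))

    arcs : {G : Fin n → Fin n → Set} → (∀ u v → Dec (G u v)) → ℕ
    arcs G? = ∑∑ (λ u v → 𝟙 (G? u v))

    ∑∑-mono : {f g : Fin n → Fin n → ℕ} → (∀ u v → f u v ≤ g u v) → ∑∑ f ≤ ∑∑ g
    ∑∑-mono f≤g = sum-mono (λ u → sum-mono (f≤g u))

    ∑∑-+ : (f g : Fin n → Fin n → ℕ) → ∑∑ (λ u v → f u v + g u v) ≡ ∑∑ f + ∑∑ g
    ∑∑-+ f g = trans (sum-cong-≗ (λ u → ∑-distrib-+ (f u) (g u))) (∑-distrib-+ (λ u → sum (f u)) (λ u → sum (g u)))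

    ∑∑-sum : ∀ {m} (f : Fin m → Fin n → Fin n → ℕ) → ∑∑ (λ u v → sum (λ i → f i u v)) ≡ sum (λ i → ∑∑ (f i))
    ∑∑-sum f = trans (sum-cong-≗ (λ u → ∑-comm (λ v i → f i u v))) (∑-comm (λ u i → sum (f i u)))

  -- The average degree that forces a path of length y ^ j among n vertices.
  density : ℕ → ℕ → ℕ → ℕ
  density n y zero    = 2
  density n y (suc j) = y * (2 * ((2 + (2 * (y * y ^ j + y * y ^ j) + density n y j)) * records n))

  module Ordered {n : ℕ} (t : Fin n → Fin n → ℕ) (T : ℕ) (t<T : ∀ u v → t u v < T)
                 (t-sym : ∀ u v → t u v ≡ t v u)
                 (t-inj : ∀ {u v w} → u ≢ v → u ≢ w → t u v ≡ t u w → v ≡ w) where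

    -- F lists the forbidden vertices, including those already visited; s bounds the next time from below.
    Ascent : (Fin n → Fin n → Set) → ℕ → List (Fin n) → Fin n → ℕ → Set
    Ascent E s F u zero    = u ∉ F
    Ascent E s F u (suc l) = u ∉ F × (∃[ v ] E u v × s ≤ t u v × Ascent E (suc (t u v)) (u ∷ F) v l)

    module _ {E : Fin n → Fin n → Set} where

      ascent-start : ∀ {s F u} l → Ascent E s F u l → u ∉ F
      ascent-start zero    u∉ = u∉
      ascent-start (suc l) p  = proj₁ p

      ascent-take : ∀ {s F u l m} → l ≤ m → Ascent E s F u m → Ascent E s F u l
      ascent-take {m = m} z≤n p = ascent-start m p
      ascent-take (s≤s l≤m) (u∉ , v , e , s≤ , p) = u∉ , v , e , s≤ , ascent-take l≤m p

      ascent-avoid : ∀ {E′ : Fin n → Fin n → Set} {s s′ F u} S l → s′ ≤ s → (∀ {a b} → E a b → E′ a b) → (∀ {a b} → E a b → b ∉ S) →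
                   u ∉ S → Ascent E s F u l → Ascent E′ s′ (F ++ S) u l
      ascent-avoid {F = F} {u} S l s′≤s E⊆E′ avoids u∉S p = go l p
        where
        u∉ : u ∉ F → u ∉ F ++ S
        u∉ u∉F u∈ with ∈-++⁻ F u∈
        ... | inj₁ q = u∉F q
        ... | inj₂ q = u∉S q
        go : ∀ l → Ascent E _ F u l → Ascent _ _ (F ++ S) u l
        go zero p = u∉ p
        go (suc l) (u∉F , v , e , s≤ , p) = u∉ u∉F , v , E⊆E′ e , ≤-trans s′≤s s≤ , ascent-avoid S l ≤-refl E⊆E′ avoids (avoids e) p

      ascent? : (∀ u v → Dec (E u v)) → ∀ s F u l → Dec (Ascent E s F u l)
      ascent? E? s F u zero    = ¬? (u ∈? F)
      ascent? E? s F u (suc l) = ¬? (u ∈? F) ×-dec any? (λ v → E? u v ×-dec (s ≤? t u v ×-dec ascent? E? (suc (t u v)) (u ∷ F) v l))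

    Robust : (Fin n → Fin n → Set) → ℕ → ℕ → Fin n → ℕ → Set
    Robust G k s u l = ∀ S → length S ≤ k → u ∉ S → Ascent G s S u l

    -- The end of the last E-edge is robust from that moment on. Applied to the forbidden and the
    -- visited vertices together, at most k by the hypothesis on lengths, robustness supplies the
    -- remaining m edges.
    ascent-extend : ∀ {E G : Fin n → Fin n → Set} {k m} → (∀ {a b} → E a b → G a b × Robust G k (suc (t a b)) b m) →
                  ∀ {s F u} l → length F + suc l ≤ k → Ascent E s F u (suc l) → Ascent G s F u (suc l + m)
    ascent-extend step {F = F} {u} l len (u∉ , v , e , s≤ , p) with step e
    ascent-extend {m = m} step {F = F} {u} zero len (u∉ , v , e , s≤ , p) | g , rob =
      u∉ , v , g , s≤ , rob (u ∷ F) (≤-trans (≤-reflexive (+-comm 1 _)) len) p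
    ascent-extend step {F = F} (suc l) len (u∉ , v , e , s≤ , p) | g , _ =
      u∉ , v , g , s≤ , ascent-extend step l (≤-trans (≤-reflexive (sym (+-suc (length F) (suc l)))) len) p

    -- The induction statement in contrapositive form. `arcs` counts every edge in both directions,
    -- so D bounds the average degree. The set U is arbitrary because the induction is applied to
    -- the vertices owned by a single one.
    Sparse : ℕ → ℕ → ℕ → Set₁
    Sparse D l k = (U : Fin n → Set) (U? : Decidable U) (G : Fin n → Fin n → Set) (G? : ∀ u v → Dec (G u v)) →
      (∀ {u v} → G u v → G v u) → (∀ {u v} → G u v → u ≢ v) → (∀ {u v} → G u v → U u) →
      (∀ {u v} → G u v → ¬ Robust G k (suc (t u v)) u l) → arcs G? ≤ D * card U?

    -- If u had more than `suc k` neighbours, then for every S of at most k vertices a later edge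
    -- than its earliest would lead outside S, so u would be robust after its earliest edge.
    Sparse-1 : ∀ k → Sparse (suc k) 1 k
    Sparse-1 k U U? G G? G-sym G-irrefl G⇒U fragile = sum-scaled (suc k) degree
      where
      degree : ∀ u → sum (λ v → 𝟙 (G? u v)) ≤ suc k * 𝟙 (U? u)
      degree u with minimal (G? u) (t u)
      ... | inj₂ none = ≤-trans (≤-reflexive (sum-zero (λ v → 𝟙-false (G? u v) (none v)))) z≤n
      ... | inj₁ (v₀ , e₀ , least) rewrite 𝟙-true (U? u) (G⇒U e₀) | *-identityʳ k = ≮⇒≥ λ big → fragile e₀ λ S len u∉S →
        -- Excluding v₀ besides S makes the time strictly later, by `t-inj`.
        let v , e , v∉ = many⇒∉ (G? u) (v₀ ∷ S) (≤-trans (s≤s (s≤s len)) big)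
        in u∉S , v , e , ≤∧≢⇒< (least v e) (λ eq → v∉ (here (t-inj (G-irrefl e) (G-irrefl e₀) (sym eq)))) ,
           λ { (here eq) → G-irrefl e (sym eq) ; (there v∈S) → v∉ (there v∈S) }

    -- The edges of one level

    module Blocked
      {U : Fin n → Set} (U? : Decidable U) {A : Fin n → Fin n → Set} (A? : ∀ u v → Dec (A u v))
      (A-irrefl : ∀ {u v} → A u v → u ≢ v) (A⇒U : ∀ {u v} → A u v → U u × U v)
      {D l k : ℕ} (1≤l : 1 ≤ l) (l≤k : l ≤ k) (sparse : Sparse D l k) (K : ℕ)
      where

      E : Fin n → Fin n → Set
      E u v = A u v ⊎ A v u

      E? : ∀ u v → Dec (E u v)
      E? u v = A? u v ⊎-dec A? v u

      E-irrefl : ∀ {u v} → E u v → u ≢ v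
      E-irrefl (inj₁ a) = A-irrefl a
      E-irrefl (inj₂ a) = A-irrefl a ∘ sym

      E⇒U : ∀ {u v} → E u v → U v
      E⇒U (inj₁ a) = proj₂ (A⇒U a)
      E⇒U (inj₂ a) = proj₁ (A⇒U a)

      module _ (blocked : ∀ {u v} → A u v → ∃[ S ] length S ≤ K × u ∉ S × ¬ Ascent E (suc (t u v)) S u l) where

        -- The blocker belongs to the earliest arc out of v and excludes paths at all later times,
        -- so one blocker per vertex serves all its arcs.
        record Life (v : Fin n) : Set where
          field
            birth   : ℕ
            earlier : ∀ {w} → A v w → birth ≤ t v w
            active  : birth < T → U v
            blocker : List (Fin n)
            small   : length blocker ≤ K
            outside : v ∉ blocker
            blocks  : ¬ Ascent E (suc birth) blocker v l

        life : ∀ v → Life v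
        life v with minimal (A? v) (t v)
        ... | inj₁ (w , a , least) = let S , small , v∉S , blocks = blocked a in record
          { birth = t v w ; earlier = least _ ; active = λ _ → proj₁ (A⇒U a)
          ; blocker = S ; small = small ; outside = v∉S ; blocks = blocks }
        -- A vertex without arcs is born at T, when all edges have passed, so the empty blocker
        -- works.
        ... | inj₂ none = record
          { birth = T ; earlier = λ a → contradiction a (none _) ; active = λ T<T → contradiction T<T (<-irrefl refl)
          ; blocker = [] ; small = z≤n ; outside = λ () ; blocks = no-edge ∘ ascent-take {m = l} 1≤l }
          where
          no-edge : ¬ Ascent E (suc T) [] v 1
          no-edge (_ , w , _ , T<t , _) = <-asym T<t (t<T v w)

        module _ (v : Fin n) where
          open Life (life v)

          -- Reached by walks, which may revisit vertices; the time bound s is exclusive.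
          Reach : Fin n → ℕ → Set
          Reach u zero    = ⊥
          Reach u (suc s) = Reach u s ⊎ (u ≡ v × birth ≤ s) ⊎ (u ∉ blocker × (∃[ w ] E w u × t w u ≡ s × Reach w s))

          reach? : ∀ u s → Dec (Reach u s)
          reach? u zero    = no λ ()
          reach? u (suc s) = reach? u s ⊎-dec ((u Fin.≟ v ×-dec birth ≤? s) ⊎-dec
            (¬? (u ∈? blocker) ×-dec any? (λ w → E? w u ×-dec (t w u ≟ s ×-dec reach? w s))))

          reach-avoids : ∀ {u} s → Reach u s → u ∉ blocker
          reach-avoids (suc s) (inj₁ r)                 = reach-avoids s r
          reach-avoids (suc s) (inj₂ (inj₁ (refl , _))) = outside
          reach-avoids (suc s) (inj₂ (inj₂ (u∉ , _)))   = u∉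

          reach-U : ∀ {u} s → s ≤ T → Reach u s → U u
          reach-U (suc s) s<T (inj₁ r)                           = reach-U s (<⇒≤ s<T) r
          reach-U (suc s) s<T (inj₂ (inj₁ (refl , b≤s)))         = active (≤-<-trans b≤s s<T)
          reach-U (suc s) s<T (inj₂ (inj₂ (_ , w , e , _))) = E⇒U e

          -- Grows at its last vertex, unlike Ascent; the list holds the vertices before u.
          data Prefix : ℕ → List (Fin n) → Fin n → Set where
            start : Prefix (suc birth) [] v
            snoc  : ∀ {s vs u w} → Prefix s vs u → E u w → s ≤ t u w → w ∉ u ∷ vs → w ∉ blocker →
                    Prefix (suc (t u w)) (u ∷ vs) w

          prefix-fresh : ∀ {s vs u} → Prefix s vs u → u ∉ vs ++ blocker
          prefix-fresh start = outside
          prefix-fresh {vs = vs} (snoc _ _ _ u∉vs u∉S) u∈ with ∈-++⁻ vs u∈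
          ... | inj₁ q = u∉vs q
          ... | inj₂ q = u∉S q

          -- The prefix lists its vertices in the order in which an `Ascent` accumulates them, so
          -- the last edge of one can be moved to the front of the other.
          prefix-ascent : ∀ {s vs u} → Prefix s vs u → ∀ m → Ascent E s (vs ++ blocker) u m → Ascent E (suc birth) blocker v (length vs + m)
          prefix-ascent start m p = p
          prefix-ascent (snoc {vs = vs} {u} {w} q e s≤ _ _) m p =
            subst (Ascent E (suc birth) blocker v) (+-suc (length vs) m)
              (prefix-ascent q (suc m) (prefix-fresh q , w , e , s≤ , p))

          prefix-cut : ∀ {s vs u w} → Prefix s vs u → w ∈ u ∷ vs → ∃[ s′ ] ∃[ vs′ ] s′ ≤ s × Prefix s′ vs′ w
          prefix-cut q (here refl) = _ , _ , ≤-refl , q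
          prefix-cut (snoc q e s≤ _ _) (there w∈) with prefix-cut q w∈
          ... | s′ , vs′ , s′≤ , q′ = s′ , vs′ , ≤-trans s′≤ (m≤n⇒m≤1+n s≤) , q′

          -- Turns a walk into a path: if the next vertex was visited before, the prefix is cut back
          -- to that visit, which only makes it end earlier.
          reach-prefix : ∀ {u} s → Reach u s → ∃[ s′ ] ∃[ vs ] s′ ≤ s × Prefix s′ vs u
          reach-prefix (suc s) (inj₁ r) with reach-prefix s r
          ... | s′ , vs , s′≤ , q = s′ , vs , m≤n⇒m≤1+n s′≤ , q
          reach-prefix (suc s) (inj₂ (inj₁ (refl , b≤s))) = suc birth , [] , s≤s b≤s , start
          reach-prefix {u} (suc s) (inj₂ (inj₂ (u∉ , w , e , refl , r))) with reach-prefix s r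
          ... | s′ , vs , s′≤ , q with u ∈? (w ∷ vs)
          ...   | no u∉vs = _ , _ , ≤-refl , snoc q e s′≤ u∉vs u∉
          ...   | yes u∈vs with prefix-cut q u∈vs
          ...     | s″ , vs′ , s″≤ , q′ = s″ , vs′ , ≤-trans s″≤ (m≤n⇒m≤1+n s′≤) , q′

          module _ {H : Fin n → Fin n → Set} (H⊆E : ∀ {a b} → H a b → E a b) (H-avoids : ∀ {a b} → H a b → b ∉ blocker) where

            -- Otherwise the path from v to u could be prolonged by l edges avoiding both that path
            -- and the blocker of v, against `blocks`. The vertices to avoid number fewer than l,
            -- hence at most k; a path that already has l edges contradicts `blocks` by itself.
            not-robust : ∀ {u s} → Reach u s → ¬ Robust H k s u l
            not-robust {u} {s} r robust with reach-prefix s r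
            ... | s′ , vs , s′≤s , q with length vs <? l
            ...   | yes short = blocks (ascent-take (m≤n+m l (length vs)) (prefix-ascent q l
                    (ascent-avoid blocker l s′≤s H⊆E H-avoids (reach-avoids s r)
                      (robust vs (≤-trans (<⇒≤ short) l≤k) (prefix-fresh q ∘ ∈-++⁺ˡ)))))
            ...   | no long = blocks (ascent-take (≤-trans (≮⇒≥ long) (m≤m+n _ 0)) (prefix-ascent q 0 (prefix-fresh q)))

        private module C (u : Fin n) = Chain (λ s v → Reach v u s) (λ s v → reach? v u s) inj₁ (λ ())

        module Ownership (pl : List (Fin n)) (all∈ : ∀ v → v ∈ pl) where
          open Life

          Owns : Fin n → Fin n → Set
          Owns v u = ∃[ s ] s < suc T × C.owner u pl s ≡ just v

          owns? : ∀ v u → Dec (Owns v u)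
          owns? v u = C.ever-owner? u pl T v

          owns-avoids : ∀ {v u} → Owns v u → u ∉ blocker (life v)
          owns-avoids {v} {u} (s , _ , eq) = reach-avoids v s (find-sound (λ v → reach? v u s) pl eq)

          -- Both ends are owned by v, possibly at different times. Leaving open which end is
          -- reached first keeps H symmetric; the blocker contains neither end, so both are reached
          -- just after the edge and `not-robust` applies.
          H : Fin n → Fin n → Fin n → Set
          H v u w = (Owns v u × Owns v w) × (E u w × (Reach v u (t u w) ⊎ Reach v w (t u w)))

          H? : ∀ v u w → Dec (H v u w)
          H? v u w = (owns? v u ×-dec owns? v w) ×-dec (E? u w ×-dec (reach? v u (t u w) ⊎-dec reach? v w (t u w)))

          H-sparse : ∀ v → arcs (H? v) ≤ D * card (owns? v)
          H-sparse v = sparse (Owns v) (owns? v) (H v) (H? v) H-sym (λ (_ , e , _) → E-irrefl e) (λ ((o , _) , _) → o)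
            λ h → not-robust v (λ (_ , e , _) → e) (λ ((_ , o) , _) → owns-avoids o) (reached h)
            where
            H-sym : ∀ {u w} → H v u w → H v w u
            H-sym {u} {w} ((o , o′) , e , r) = (o′ , o) , swap e ,
              subst (λ s → Reach v w s ⊎ Reach v u s) (t-sym u w) (swap r)
            reached : ∀ {u w} → H v u w → Reach v u (suc (t u w))
            reached (_ , _ , inj₁ r) = inj₁ r
            reached {u} {w} ((o , _) , e , inj₂ r) = inj₂ (inj₂ (owns-avoids o , w , swap e , t-sym w u , r))

          owner : Fin n → ℕ → Maybe (Fin n)
          owner u s = C.owner u pl s

          -- If both owners survive the edge, call them v for u and x for w. Unless a blocker
          -- intervenes, the edge lets v reach w and x reach u, so `find-antisym` makes them equal.
          classify : ∀ {u w} → A u w → let s = t u w in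
            owner u s ≢ owner u (suc s) ⊎ owner w s ≢ owner w (suc s) ⊎
            (∃[ v ] Owns v u × w ∈ blocker (life v)) ⊎ (∃[ v ] Owns v w × u ∈ blocker (life v)) ⊎ (∃[ v ] H v u w)
          classify {u} {w} a
            with Maybe.≡-dec Fin._≟_ (owner u s) (owner u (suc s)) | Maybe.≡-dec Fin._≟_ (owner w s) (owner w (suc s))
            where s = t u w
          ... | no change | _ = inj₁ change
          ... | yes _ | no change = inj₂ (inj₁ change)
          ... | yes same-u | yes same-w
            -- By its birth u reaches itself, so it has an owner after the edge, and the same owner
            -- before it.
            with find-complete (λ v → reach? v u (suc (t u w))) (all∈ u) (inj₂ (inj₁ (refl , earlier (life u) a)))
          ...   | v , v-owns-u′ with w ∈? blocker (life v)
          ...     | yes w∈ = inj₂ (inj₂ (inj₁ (v , (t u w , m≤n⇒m≤1+n (t<T u w) , trans same-u v-owns-u′) , w∈)))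
          ...     | no w∉
            with find-complete (λ v → reach? v w (suc (t u w))) (all∈ v) (inj₂ (inj₂ (w∉ , u , inj₁ a , refl , v-reaches-u)))
            where v-reaches-u = find-sound (λ v → reach? v u (t u w)) pl (trans same-u v-owns-u′)
          ...       | x , x-owns-w′ with u ∈? blocker (life x)
          ...         | yes u∈ = inj₂ (inj₂ (inj₂ (inj₁ (x , (t u w , m≤n⇒m≤1+n (t<T u w) , trans same-w x-owns-w′) , u∈))))
          ...         | no u∉ = inj₂ (inj₂ (inj₂ (inj₂ (v ,
                          ((s , m≤n⇒m≤1+n (t<T u w) , trans same-u v-owns-u′) ,
                           (s , m≤n⇒m≤1+n (t<T u w) , trans same-w (trans x-owns-w′ (cong just (sym v≡x))))) ,
                          inj₁ a , inj₁ v-reaches-u))))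
            where
            s = t u w
            v-reaches-u = find-sound (λ v → reach? v u s) pl (trans same-u v-owns-u′)
            x-reaches-w = find-sound (λ v → reach? v w s) pl (trans same-w x-owns-w′)
            v≡x : v ≡ x
            v≡x = find-antisym (λ v → reach? v u (suc s)) (λ v → reach? v w (suc s)) pl v-owns-u′ x-owns-w′
              (inj₂ (inj₂ (w∉ , u , inj₁ a , refl , v-reaches-u)))
              (inj₂ (inj₂ (u∉ , w , inj₂ a , t-sym w u , x-reaches-w)))

          totalChanges : ℕ
          totalChanges = sum (λ u → C.changes u pl T)

          -- One charge for each case of `classify`. By `t-inj` a change of the owner of u pays for
          -- at most one arc out of u and one into u. Each owner of u pays for at most K arcs in
          -- either direction through its blocker, and the induction bounds the arcs inside what one
          -- v owns.
          f₁ f₂ f₃ f₄ f₅ : Fin n → Fin n → ℕ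
          f₁ u w = 𝟙 (A? u w) * 𝟙 (C.change? u pl (t u w))
          f₂ u w = 𝟙 (A? u w) * 𝟙 (C.change? w pl (t u w))
          f₃ u w = sum (λ v → 𝟙 (owns? v u) * 𝟙 (w ∈? blocker (life v)))
          f₄ u w = f₃ w u
          f₅ u w = sum (λ v → 𝟙 (H? v u w))

          open ≤-Reasoning

          arc≤ : ∀ u w → 𝟙 (A? u w) ≤ f₁ u w + (f₂ u w + (f₃ u w + (f₄ u w + f₅ u w)))
          arc≤ u w = 𝟙-bound (A? u w) λ a → by a (classify a)
            where
            1≤* : ∀ {x y} → x ≡ 1 → y ≡ 1 → 1 ≤ x * y
            1≤* refl refl = ≤-refl
            by : A u w → _ → 1 ≤ f₁ u w + (f₂ u w + (f₃ u w + (f₄ u w + f₅ u w)))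
            by a (inj₁ c) = ≤-trans (1≤* (𝟙-true (A? u w) a) (𝟙-true (C.change? u pl (t u w)) c)) (m≤m+n _ _)
            by a (inj₂ (inj₁ c)) = m≤n⇒m≤o+n (f₁ u w)
              (≤-trans (1≤* (𝟙-true (A? u w) a) (𝟙-true (C.change? w pl (t u w)) c)) (m≤m+n _ _))
            by a (inj₂ (inj₂ (inj₁ (v , o , w∈)))) = m≤n⇒m≤o+n (f₁ u w) (m≤n⇒m≤o+n (f₂ u w)
              (≤-trans (≤-trans (1≤* (𝟙-true (owns? v u) o) (𝟙-true (w ∈? blocker (life v)) w∈))
                (term≤sum (λ v → 𝟙 (owns? v u) * 𝟙 (w ∈? blocker (life v))) v)) (m≤m+n _ _)))
            by a (inj₂ (inj₂ (inj₂ (inj₁ (v , o , u∈))))) = m≤n⇒m≤o+n (f₁ u w) (m≤n⇒m≤o+n (f₂ u w) (m≤n⇒m≤o+n (f₃ u w)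
              (≤-trans (≤-trans (1≤* (𝟙-true (owns? v w) o) (𝟙-true (u ∈? blocker (life v)) u∈))
                (term≤sum (λ v → 𝟙 (owns? v w) * 𝟙 (u ∈? blocker (life v))) v)) (m≤m+n _ _))))
            by a (inj₂ (inj₂ (inj₂ (inj₂ (v , h))))) = m≤n⇒m≤o+n (f₁ u w) (m≤n⇒m≤o+n (f₂ u w) (m≤n⇒m≤o+n (f₃ u w) (m≤n⇒m≤o+n (f₄ u w)
              (≤-trans (≤-reflexive (sym (𝟙-true (H? v u w) h))) (term≤sum (λ v → 𝟙 (H? v u w)) v)))))

          ∑f₁ : ∑∑ f₁ ≤ totalChanges
          ∑f₁ = sum-mono λ u → sum-reindex (A? u) (t u) T (λ s → 𝟙 (C.change? u pl s)) (t<T u)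
            (λ a b → t-inj (A-irrefl a) (A-irrefl b))

          ∑f₂ : ∑∑ f₂ ≤ totalChanges
          ∑f₂ = ≤-trans (≤-reflexive (∑-comm f₂)) (sum-mono λ w →
            sum-reindex (λ u → A? u w) (λ u → t u w) T (λ s → 𝟙 (C.change? w pl s)) (λ u → t<T u w)
            (λ {i} {j} a b eq → t-inj (A-irrefl a ∘ sym) (A-irrefl b ∘ sym) (trans (t-sym w i) (trans eq (t-sym j w)))))

          owners : ∀ u → sum (λ v → 𝟙 (owns? v u)) ≤ C.changes u pl T
          owners u = C.owners≤changes u pl T

          ∑f₃ : ∑∑ f₃ ≤ K * totalChanges
          ∑f₃ = sum-scaled K λ u → begin
            sum (λ w → sum (λ v → 𝟙 (owns? v u) * 𝟙 (w ∈? blocker (life v))))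
              ≡⟨ ∑-comm (λ w v → 𝟙 (owns? v u) * 𝟙 (w ∈? blocker (life v))) ⟩
            sum (λ v → sum (λ w → 𝟙 (owns? v u) * 𝟙 (w ∈? blocker (life v))))
              ≡⟨ sum-cong-≗ (λ v → sym (*-distribˡ-sum (𝟙 (owns? v u)) (λ w → 𝟙 (w ∈? blocker (life v))))) ⟩
            sum (λ v → 𝟙 (owns? v u) * sum (λ w → 𝟙 (w ∈? blocker (life v))))
              ≤⟨ sum-scaled K (λ v → ≤-trans (*-monoʳ-≤ (𝟙 (owns? v u)) (≤-trans (count-∈ (blocker (life v))) (small (life v)))) (≤-reflexive (*-comm _ K))) ⟩
            K * sum (λ v → 𝟙 (owns? v u))
              ≤⟨ *-monoʳ-≤ K (owners u) ⟩
            K * C.changes u pl T ∎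

          ∑f₄ : ∑∑ f₄ ≤ K * totalChanges
          ∑f₄ = ≤-trans (≤-reflexive (∑-comm f₄)) ∑f₃

          ∑f₅ : ∑∑ f₅ ≤ D * totalChanges
          ∑f₅ = begin
            ∑∑ f₅ ≡⟨ ∑∑-sum (λ v u w → 𝟙 (H? v u w)) ⟩
            sum (λ v → arcs (H? v)) ≤⟨ sum-scaled D H-sparse ⟩
            D * sum (λ v → sum (λ u → 𝟙 (owns? v u))) ≡⟨ cong (D *_) (∑-comm (λ v u → 𝟙 (owns? v u))) ⟩
            D * sum (λ u → sum (λ v → 𝟙 (owns? v u))) ≤⟨ *-monoʳ-≤ D (sum-mono owners) ⟩
            D * totalChanges ∎

          arcs≤changes : arcs A? ≤ (2 + (2 * K + D)) * totalChanges
          arcs≤changes = begin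
            arcs A? ≤⟨ ∑∑-mono arc≤ ⟩
            ∑∑ (λ u w → f₁ u w + (f₂ u w + (f₃ u w + (f₄ u w + f₅ u w))))
              ≡⟨ trans (∑∑-+ f₁ _) (cong (∑∑ f₁ +_) (trans (∑∑-+ f₂ _) (cong (∑∑ f₂ +_) (trans (∑∑-+ f₃ _) (cong (∑∑ f₃ +_) (∑∑-+ f₄ f₅)))))) ⟩
            ∑∑ f₁ + (∑∑ f₂ + (∑∑ f₃ + (∑∑ f₄ + ∑∑ f₅)))
              ≤⟨ +-mono-≤ ∑f₁ (+-mono-≤ ∑f₂ (+-mono-≤ ∑f₃ (+-mono-≤ ∑f₄ ∑f₅))) ⟩
            totalChanges + (totalChanges + (K * totalChanges + (K * totalChanges + D * totalChanges))) ≡⟨ rearrange totalChanges K D ⟩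
            (2 + (2 * K + D)) * totalChanges ∎
            where
            rearrange : ∀ c k d → c + (c + (k * c + (k * c + d * c))) ≡ (2 + (2 * k + d)) * c
            rearrange = solve-∀

        -- Vertices outside U are never reached up to T and contribute `records 0`, which is 0; the
        -- others are reached from at most n vertices and contribute at most `records n`.
        few-arcs : arcs A? ≤ (2 + (2 * K + D)) * (records n * card U?)
        few-arcs with few-changes (λ u s v → Reach v u s) (λ u s v → reach? v u s) inj₁ (λ ()) id (λ _ → T)
        ... | pl , all∈ , le = ≤-trans (Ownership.arcs≤changes pl all∈)
                (*-monoʳ-≤ (2 + (2 * K + D)) (≤-trans le (sum-scaled (records n) reached)))
          where
          reached : ∀ u → records (C.present u id T) ≤ records n * 𝟙 (U? u)
          reached u with U? u
          ... | yes _ = ≤-trans (records-mono (≤-trans (sum-bounded (λ v → 𝟙≤1 (reach? v u T))) (≤-reflexive (*-identityʳ n)))) (≤-reflexive (sym (*-identityʳ (records n))))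
          ... | no ¬U = ≤-trans (≤-reflexive (cong records (sum-zero (λ v → 𝟙-false (reach? v u T) (¬U ∘ reach-U v T ≤-refl))))) z≤n

    -- Splitting the edges into levels

    module Heights {U : Fin n → Set} (U? : Decidable U) {G : Fin n → Fin n → Set} (G? : ∀ u v → Dec (G u v))
      (G-sym : ∀ {u v} → G u v → G v u) (G-irrefl : ∀ {u v} → G u v → u ≢ v) (G⇒U : ∀ {u v} → G u v → U u)
      {D l k : ℕ} (1≤l : 1 ≤ l) (l≤k : l ≤ k) (sparse : Sparse D l k) (y k′ : ℕ)
      (fragile : ∀ {u v} → G u v → ¬ Robust G k′ (suc (t u v)) u (y * l))
      where

      -- A path of level h is glued behind one of length l, whose vertices it must avoid besides a
      -- blocker of level `suc h`. Hence the budget falls by l per level, down to k′ at level y.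
      budget : ℕ → ℕ
      budget h = k′ + (y ∸ h) * l

      High : ℕ → Fin n → ℕ → Set
      High h u s = Robust G (budget h) s u (h * l)

      Blocker : ℕ → Fin n → ℕ → Set
      Blocker h u s = ∃[ S ] length S ≤ budget h × u ∉ S × ¬ Ascent G s S u (h * l)

      -- Failure of robustness is recorded by an explicit blocking set, which the counting needs.
      Verdict : ℕ → Fin n → ℕ → Set
      Verdict h u s = High h u s ⊎ Blocker h u s

      ¬¬-verdict : ∀ h u s → ¬ ¬ Verdict h u s
      ¬¬-verdict h u s neither = neither (inj₁ λ S small u∉S → decidable-stable (ascent? G? s S u (h * l))
        λ ¬p → neither (inj₂ (S , small , u∉S , ¬p)))

      factor : ℕ
      factor = (2 + (2 * (k′ + y * l) + D)) * records n

      module _ (verdict : ∀ (h : Fin y) x u v → Verdict (toℕ h) x (suc (t u v)) × Verdict (suc (toℕ h)) x (suc (t u v))) where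

        decide : ∀ h x s → Verdict h x s → Dec (High h x s)
        decide _ _ _ (inj₁ high) = yes high
        decide _ _ _ (inj₂ (S , small , x∉S , ¬p)) = no λ high → ¬p (high S small x∉S)

        A : Fin y → Fin n → Fin n → Set
        A h u v = G u v × High (toℕ h) u (suc (t u v)) × High (toℕ h) v (suc (t u v)) × ¬ High (suc (toℕ h)) u (suc (t u v))

        A? : ∀ h u v → Dec (A h u v)
        A? h u v = G? u v ×-dec (decide (toℕ h) u (suc (t u v)) (proj₁ (verdict h u u v)) ×-dec
          (decide (toℕ h) v (suc (t u v)) (proj₁ (verdict h v u v)) ×-dec
          ¬? (decide (suc (toℕ h)) u (suc (t u v)) (proj₂ (verdict h u u v)))))

        -- Level 0 asks only for paths of length 0. Both ends cannot climb to level y, by `fragile`;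
        -- at the first failure an end that fails becomes the source of the arc.
        level : ∀ {u v} → G u v → ∃[ h ] (A h u v ⊎ A h v u)
        level {u} {v} g with any? (λ h → A? h u v ⊎-dec A? h v u)
        ... | yes p = p
        ... | no ¬p = contradiction top (fragile g)
          where
          s = suc (t u v)
          back : ∀ h x → High h x s → High h x (suc (t v u))
          back h x = subst (λ r → High h x (suc r)) (t-sym u v)
          climb : ∀ h → h ≤ y → High h u s × High h v s
          climb zero    _   = (λ _ _ u∉ → u∉) , (λ _ _ v∉ → v∉)
          climb (suc h) h<y with fromℕ< h<y | Fin.toℕ-fromℕ< h<y | climb h (<⇒≤ h<y)
          ... | i | refl | high-u , high-v with decide (suc (toℕ i)) u s (proj₂ (verdict i u u v)) | decide (suc (toℕ i)) v s (proj₂ (verdict i v u v))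
          ...   | yes p | yes q = p , q
          ...   | no ¬q | _     = contradiction (i , inj₁ (g , high-u , high-v , ¬q)) ¬p
          ...   | yes _ | no ¬q = contradiction
                  (i , inj₂ (G-sym g , back (toℕ i) v high-v , back (toℕ i) u high-u , ¬q ∘ subst (λ r → High (suc (toℕ i)) v (suc r)) (t-sym v u))) ¬p
          top : Robust G k′ s u (y * l)
          top = subst (λ b → Robust G b s u (y * l)) (trans (cong (λ d → k′ + d * l) (n∸n≡0 y)) (+-identityʳ k′)) (proj₁ (climb y ≤-refl))

        -- A path of length l in this level that avoids the blocker of level `suc i` would end at a
        -- vertex robust for `i * l` more edges, and `ascent-extend` would build the path of length
        -- `suc i * l` that the blocker excludes.
        sparse-level : ∀ h → arcs (A? h) ≤ factor * card U?
        sparse-level h = ≤-trans (Blocked.few-arcs U? (A? h) (G-irrefl ∘ proj₁) (λ (g , _) → G⇒U g , G⇒U (G-sym g))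
            1≤l l≤k sparse (k′ + y * l) blocked) (≤-reflexive (sym (*-assoc (2 + (2 * (k′ + y * l) + D)) (records n) _)))
          where
          i = toℕ h
          E : Fin n → Fin n → Set
          E u v = A h u v ⊎ A h v u
          pays : k′ + (y ∸ suc i) * l + l ≡ budget i
          pays = trans (+-assoc k′ _ l) (cong (k′ +_) (trans (+-comm ((y ∸ suc i) * l) l)
            (cong (_* l) (sym (+-∸-assoc 1 (Fin.toℕ<n h))))))
          step : ∀ {u v} → E u v → G u v × High i v (suc (t u v))
          step (inj₁ (g , _ , high-v , _)) = g , high-v
          step {u} {v} (inj₂ (g , high-v , _)) = G-sym g , subst (λ r → High i v (suc r)) (t-sym v u) high-v
          blocked : ∀ {u v} → A h u v → ∃[ S ] length S ≤ k′ + y * l × u ∉ S × ¬ Ascent E (suc (t u v)) S u l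
          blocked {u} {v} (_ , _ , _ , ¬high) with proj₂ (verdict h u u v)
          ... | inj₁ high = contradiction high ¬high
          ... | inj₂ (S , small , u∉S , ¬ascent) = S , ≤-trans small (+-monoʳ-≤ k′ (*-monoˡ-≤ l (m∸n≤m y (suc i)))) , u∉S ,
            λ p → ¬ascent (extend (suc (t u v)) S u l 1≤l (≤-trans (+-monoˡ-≤ l small) (≤-reflexive pays)) p)
            where
            extend : ∀ s S u l′ → 1 ≤ l′ → length S + l′ ≤ budget i → Ascent E s S u l′ → Ascent G s S u (l′ + i * l)
            extend s S u (suc l′) _ len p = ascent-extend step l′ len p

        total : arcs G? ≤ (y * (2 * factor)) * card U?
        total = begin
          arcs G? ≤⟨ ∑∑-mono split ⟩
          ∑∑ (λ u v → sum (λ h → 𝟙 (A? h u v) + 𝟙 (A? h v u)))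
            ≡⟨ ∑∑-sum (λ h u v → 𝟙 (A? h u v) + 𝟙 (A? h v u)) ⟩
          sum (λ h → ∑∑ (λ u v → 𝟙 (A? h u v) + 𝟙 (A? h v u)))
            ≤⟨ sum-bounded (λ h → begin
                 ∑∑ (λ u v → 𝟙 (A? h u v) + 𝟙 (A? h v u)) ≡⟨ ∑∑-+ (λ u v → 𝟙 (A? h u v)) (λ u v → 𝟙 (A? h v u)) ⟩
                 arcs (A? h) + ∑∑ (λ u v → 𝟙 (A? h v u)) ≡⟨ cong (arcs (A? h) +_) (∑-comm (λ u v → 𝟙 (A? h v u))) ⟩
                 arcs (A? h) + arcs (A? h) ≤⟨ +-mono-≤ (sparse-level h) (sparse-level h) ⟩
                 factor * card U? + factor * card U? ∎) ⟩
          y * (factor * card U? + factor * card U?) ≡⟨ rearrange y factor (card U?) ⟩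
          (y * (2 * factor)) * card U? ∎
          where
          open ≤-Reasoning
          rearrange : ∀ y f c → y * (f * c + f * c) ≡ (y * (2 * f)) * c
          rearrange = solve-∀
          split : ∀ u v → 𝟙 (G? u v) ≤ sum (λ h → 𝟙 (A? h u v) + 𝟙 (A? h v u))
          split u v = 𝟙-bound (G? u v) λ g → let h , a = level g in
            ≤-trans (by h a) (term≤sum (λ h → 𝟙 (A? h u v) + 𝟙 (A? h v u)) h)
            where
            by : ∀ h → A h u v ⊎ A h v u → 1 ≤ 𝟙 (A? h u v) + 𝟙 (A? h v u)
            by h (inj₁ a) = ≤-trans (≤-reflexive (sym (𝟙-true (A? h u v) a))) (m≤m+n _ _)
            by h (inj₂ a) = ≤-trans (≤-reflexive (sym (𝟙-true (A? h v u) a))) (m≤n+m _ _)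

      -- The inequality is decidable, so the finitely many verdicts, known up to double negation,
      -- may be assumed.
      arcs-bound : arcs G? ≤ (y * (2 * factor)) * card U?
      arcs-bound = decidable-stable (_ ≤? _) λ ¬le →
        (¬¬-∀ λ h → ¬¬-∀ λ x → ¬¬-∀ λ u → ¬¬-∀ λ v → λ k → ¬¬-verdict (toℕ h) x (suc (t u v)) λ low →
          ¬¬-verdict (suc (toℕ h)) x (suc (t u v)) λ high → k (low , high))
        λ verdict → ¬le (total verdict)

    Sparse-step : ∀ {D l k} y k′ → 1 ≤ l → l ≤ k → Sparse D l k →
                  Sparse (y * (2 * ((2 + (2 * (k′ + y * l) + D)) * records n))) (y * l) k′
    Sparse-step y k′ 1≤l l≤k sparse U U? G G? G-sym G-irrefl G⇒U fragile =
      Heights.arcs-bound U? G? G-sym G-irrefl G⇒U 1≤l l≤k sparse y k′ fragile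

    -- `Sparse-step` requires l ≤ k; taking k equal to the length at every stage satisfies this.
    Sparse-power : ∀ y .{{_ : NonZero y}} j → Sparse (density n y j) (y ^ j) (y ^ j)
    Sparse-power y zero    = Sparse-1 1
    Sparse-power y (suc j) = Sparse-step y (y * y ^ j) (m^n>0 y j) ≤-refl (Sparse-power y j)

    -- Without such an ascent no vertex is robust, even against the empty set, so `Sparse-power`
    -- would bound the degree `pred n` of the complete graph by the density.
    long-ascent : ∀ y .{{_ : NonZero y}} j → density n y j < pred n → ∃[ u ] Ascent _≢_ 0 [] u (y ^ j)
    long-ascent y j deg< with any? (λ u → ascent? (λ u v → ¬? (u Fin.≟ v)) 0 [] u (y ^ j))
    ... | yes p = p
    ... | no ¬p = contradiction (Sparse-power y j (λ _ → ⊤) (λ _ → yes tt) _≢_ distinct? (λ u≢v → u≢v ∘ sym) id (λ _ → tt)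
                    λ {u} _ robust → ¬p (u , weaken (y ^ j) (robust [] z≤n (λ ()))))
                  (<⇒≱ (begin-strict
                    density n y j * card {n} {λ _ → ⊤} (λ _ → yes tt) ≡⟨ cong (density n y j *_) (trans (sum-const n 1) (*-identityʳ n)) ⟩
                    density n y j * n  <⟨ *-monoˡ-< n {{>-nonZero (≤-trans (s≤s z≤n) (≤-trans deg< pred[n]≤n))}} deg< ⟩
                    pred n * n      ≡⟨ *-comm (pred n) n ⟩
                    n * pred n      ≡⟨ sum-const n (pred n) ⟨
                    sum {n} (λ _ → pred n) ≤⟨ sum-mono neighbours ⟩
                    arcs distinct? ∎))
      where
      open ≤-Reasoning
      distinct? : ∀ (u v : Fin n) → Dec (u ≢ v)
      distinct? u v = ¬? (u Fin.≟ v)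
      weaken : ∀ {s u} m → Ascent _≢_ s [] u m → Ascent _≢_ 0 [] u m
      weaken zero    p = p
      weaken (suc m) (u∉ , v , e , _ , p) = u∉ , v , e , z≤n , p
      neighbours : ∀ u → pred n ≤ sum (λ v → 𝟙 (¬? (u Fin.≟ v)))
      neighbours u = +-cancelˡ-≤ 1 _ _ (begin
        suc (pred n) ≡⟨ suc-pred n {{Fin.nonZeroIndex u}} ⟩
        n            ≡⟨ trans (sum-const n 1) (*-identityʳ n) ⟨
        sum {n} (λ _ → 1) ≤⟨ sum-mono one ⟩
        sum (λ v → 𝟙 (u Fin.≟ v) + 𝟙 (¬? (u Fin.≟ v))) ≡⟨ ∑-distrib-+ (λ v → 𝟙 (u Fin.≟ v)) (λ v → 𝟙 (¬? (u Fin.≟ v))) ⟩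
        sum (λ v → 𝟙 (u Fin.≟ v)) + sum (λ v → 𝟙 (¬? (u Fin.≟ v))) ≤⟨ +-monoˡ-≤ _ (count-unique (u Fin.≟_) (λ p q → trans (sym p) q)) ⟩
        1 + sum (λ v → 𝟙 (¬? (u Fin.≟ v))) ∎)
        where
        one : ∀ v → 1 ≤ 𝟙 (u Fin.≟ v) + 𝟙 (¬? (u Fin.≟ v))
        one v with u Fin.≟ v
        ... | yes _ = ≤-refl
        ... | no _  = ≤-refl

  -- From edge-orderings to edge times

  module _ {n : ℕ} (o : EdgeOrdering (K n)) where
    open EdgeOrdering o
    open IsTotalOrder isTotalOrder using (total; antisym) renaming (trans to ≼-trans; reflexive to ≼-reflexive)

    SameEdge : Fin n → Fin n → Fin n → Fin n → Set
    SameEdge u v u′ v′ = (u ≡ u′ × v ≡ v′) ⊎ (u ≡ v′ × v ≡ u′)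

    same? : ∀ u v u′ v′ → Dec (SameEdge u v u′ v′)
    same? u v u′ v′ = (u Fin.≟ u′ ×-dec v Fin.≟ v′) ⊎-dec (u Fin.≟ v′ ×-dec v Fin.≟ u′)

    private
      ≼-same : ∀ {u v u′ v′} {q : u ≢ v} {q′ : u′ ≢ v′} → SameEdge u v u′ v′ → edge u v q ≼ edge u′ v′ q′
      ≼-same = ≼-reflexive

    -- Quantifying over the adjacency proofs makes `time` depend on vertices alone; `≼-same` passes
    -- between different proofs.
    Before : Fin n → Fin n → Fin n → Fin n → Set
    Before a b u v = ∃[ p ] ∃[ q ] edge a b p ≼ edge u v q × ¬ SameEdge a b u v

    before? : ∀ a b u v → Dec (Before a b u v)
    before? a b u v with a Fin.≟ b | u Fin.≟ v | same? a b u v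
    ... | yes a≡b | _       | _      = no λ (p , _) → p a≡b
    ... | no _    | yes u≡v | _      = no λ (_ , q , _) → q u≡v
    ... | no _    | no _    | yes s  = no λ (_ , _ , _ , ¬s) → ¬s s
    ... | no p    | no q    | no ¬s with total (edge a b p) (edge u v q)
    ...   | inj₁ le = yes (p , q , le , ¬s)
    ...   | inj₂ ge = no λ (p′ , q′ , le , _) → ¬s (antisym {edge a b p} {edge u v q}
                        (≼-trans (≼-same {q = p} {p′} (inj₁ (refl , refl))) (≼-trans le (≼-same {q = q′} {q} (inj₁ (refl , refl))))) ge)

    -- The rank of the edge, with every smaller edge counted in both orientations.
    time : Fin n → Fin n → ℕ
    time u v = ∑∑ (λ a b → 𝟙 (before? a b u v))

    private
      before-≼ : ∀ {u v u′ v′} (q : u ≢ v) (q′ : u′ ≢ v′) → edge u v q ≼ edge u′ v′ q′ →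
                 ∀ {a b} → Before a b u v → Before a b u′ v′
      before-≼ {u} {v} q q′ le {a} {b} (p , r , le′ , ¬s) = p , q′ , ≼-trans le′ step , λ s →
        ¬s (antisym {edge a b p} {edge u v r} le′ (≼-trans (≼-same {q = r} {q} (inj₁ (refl , refl))) (≼-trans le (≼-same {q = q′} {p} (flip s)))))
        where
        step : edge u v r ≼ edge _ _ q′
        step = ≼-trans (≼-same {q = r} {q} (inj₁ (refl , refl))) le
        flip : ∀ {a b u v} → SameEdge a b u v → SameEdge u v a b
        flip (inj₁ (refl , refl)) = inj₁ (refl , refl)
        flip (inj₂ (refl , refl)) = inj₂ (refl , refl)

    time-≤ : ∀ {u v u′ v′} (q : u ≢ v) (q′ : u′ ≢ v′) → edge u v q ≼ edge u′ v′ q′ → time u v ≤ time u′ v′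
    time-≤ {u} {v} {u′} {v′} q q′ le = ∑∑-mono λ a b → 𝟙≤ (before? a b u v) (before? a b u′ v′) (before-≼ q q′ le)

    time-< : ∀ {u v u′ v′} (q : u ≢ v) (q′ : u′ ≢ v′) → edge u v q ≼ edge u′ v′ q′ → ¬ SameEdge u v u′ v′ → time u v < time u′ v′
    time-< {u} {v} {u′} {v′} q q′ le ¬s =
      -- The pair (u , v) makes the inequality strict: it precedes the larger edge but not itself.
      sum-mono-< (λ a → sum-mono (mono a)) u (sum-mono-< (mono u) v strict)
      where
      mono : ∀ a b → 𝟙 (before? a b u v) ≤ 𝟙 (before? a b u′ v′)
      mono a b = 𝟙≤ (before? a b u v) (before? a b u′ v′) (before-≼ q q′ le)
      strict : 𝟙 (before? u v u v) < 𝟙 (before? u v u′ v′)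
      strict rewrite 𝟙-false (before? u v u v) (λ (_ , _ , _ , ¬s) → ¬s (inj₁ (refl , refl)))
                   | 𝟙-true (before? u v u′ v′) (q , q′ , le , ¬s) = ≤-refl

    time-≼ : ∀ {u v u′ v′} (q : u ≢ v) (q′ : u′ ≢ v′) → time u v ≤ time u′ v′ → edge u v q ≼ edge u′ v′ q′
    time-≼ {u} {v} {u′} {v′} q q′ le with total (edge u v q) (edge u′ v′ q′)
    ... | inj₁ u≼v = u≼v
    ... | inj₂ v≼u with same? u′ v′ u v
    ...   | no ¬s = contradiction le (<⇒≱ (time-< q′ q v≼u ¬s))
    ...   | yes (inj₁ (refl , refl)) = ≼-same (inj₁ (refl , refl))
    ...   | yes (inj₂ (refl , refl)) = ≼-same (inj₂ (refl , refl))

    time-bound : ∀ u v → time u v < suc (n * (n * 1))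
    time-bound u v = s≤s (sum-bounded λ a → sum-bounded λ b → 𝟙≤1 (before? a b u v))

    time-sym : ∀ u v → time u v ≡ time v u
    time-sym u v = by-cases (u Fin.≟ v)
      where
      by-cases : Dec (u ≡ v) → time u v ≡ time v u
      by-cases (yes u≡v) = cong₂ time u≡v (sym u≡v)
      by-cases (no u≢v)  = ≤-antisym (time-≤ u≢v (u≢v ∘ sym) (≼-same (inj₂ (refl , refl))))
                                     (time-≤ (u≢v ∘ sym) u≢v (≼-same (inj₂ (refl , refl))))

    time-injective : ∀ {u v w} → u ≢ v → u ≢ w → time u v ≡ time u w → v ≡ w
    time-injective {u} {v} {w} u≢v u≢w eq
      with antisym (time-≼ u≢v u≢w (≤-reflexive eq)) (time-≼ u≢w u≢v (≤-reflexive (sym eq)))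
    ... | inj₁ (_ , v≡w)    = v≡w
    ... | inj₂ (u≡w , _) = contradiction u≡w u≢w

    open Ordered time _ time-bound time-sym time-injective

    -- Ascents as monotone paths

    vertices : ∀ {s F u} m → Ascent _≢_ s F u m → Fin (suc m) → Fin n
    vertices {u = u} m       p                    zero    = u
    vertices         (suc m) (_ , v , _ , _ , p) (suc i) = vertices m p i

    vertices-∉ : ∀ {s F u} m (p : Ascent _≢_ s F u m) i → vertices m p i ∉ F
    vertices-∉ m       p                    zero    = ascent-start m p
    vertices-∉ (suc m) (_ , v , _ , _ , p) (suc i) = vertices-∉ m p i ∘ there

    vertices-injective : ∀ {s F u} m (p : Ascent _≢_ s F u m) → Injective _≡_ _≡_ (vertices m p)
    vertices-injective m       p                   {zero}  {zero}  eq = refl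
    vertices-injective (suc m) (_ , _ , _ , _ , p) {zero}  {suc j} eq = contradiction (here (sym eq)) (vertices-∉ m p j)
    vertices-injective (suc m) (_ , _ , _ , _ , p) {suc i} {zero}  eq = contradiction (here eq) (vertices-∉ m p i)
    vertices-injective (suc m) (_ , _ , _ , _ , p) {suc i} {suc j} eq = cong suc (vertices-injective m p eq)

    times : ∀ {s F u} m → Ascent _≢_ s F u m → Fin m → ℕ
    times m p i = time (vertices m p (inject₁ i)) (vertices m p (suc i))

    vertices-adjacent : ∀ {s F u} m (p : Ascent _≢_ s F u m) i → vertices m p (inject₁ i) ≢ vertices m p (suc i)
    vertices-adjacent (suc m) (_ , _ , e , _ , p) zero    = e
    vertices-adjacent (suc m) (_ , _ , _ , _ , p) (suc i) = vertices-adjacent m p i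

    times-≥ : ∀ {s F u} m (p : Ascent _≢_ s F u m) i → s ≤ times m p i
    times-≥ (suc m) (_ , _ , _ , s≤ , p) zero    = s≤
    times-≥ (suc m) (_ , _ , _ , s≤ , p) (suc i) = ≤-trans s≤ (<⇒≤ (times-≥ m p i))

    times-mono : ∀ {s F u} m (p : Ascent _≢_ s F u m) {i j} → i Fin.≤ j → times m p i ≤ times m p j
    times-mono (suc m) (_ , _ , _ , _ , p) {zero}  {zero}  _         = ≤-refl
    times-mono (suc m) (_ , _ , _ , _ , p) {zero}  {suc j} _         = <⇒≤ (times-≥ m p j)
    times-mono (suc m) (_ , _ , _ , _ , p) {suc i} {suc j} (s≤s i≤j) = times-mono m p i≤j

    monotone-path : ∀ {s F u} m → Ascent _≢_ s F u m → HasMonotonePath (K n) o m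
    monotone-path m p = record
      { vertex = vertices m p ; distinct = vertices-injective m p ; adjacent = vertices-adjacent m p } ,
      inj₁ λ i≤j → time-≼ (vertices-adjacent m p _) (vertices-adjacent m p _) (times-mono m p i≤j)

    long-monotone-path : ∀ y .{{_ : NonZero y}} j → density n y j < pred n → HasMonotonePath (K n) o (y ^ j)
    long-monotone-path y j dense = monotone-path (y ^ j) (proj₂ (long-ascent y j dense))

  -- Choice of parameters

  open ≤-Reasoning

  2^-cancel-≤ : ∀ {a b} → 2 ^ a ≤ 2 ^ b → a ≤ b
  2^-cancel-≤ le = ≮⇒≥ λ b<a → contradiction le (<⇒≱ (^-monoʳ-< 2 (s≤s (s≤s z≤n)) b<a))

  2^-cancel-< : ∀ {a b} → 2 ^ a < 2 ^ b → a < b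
  2^-cancel-< lt = ≰⇒> λ b≤a → contradiction lt (≤⇒≯ (^-monoʳ-≤ 2 b≤a))

  1≤2^ : ∀ a → 1 ≤ 2 ^ a
  1≤2^ a = m^n>0 2 a

  2^bitlength≤ : ∀ c → 2 ^ bitlength (suc c) ≤ 2 * suc c
  2^bitlength≤ zero = ≤-refl
  2^bitlength≤ (suc c) with 2^bitlength≤ c
  ... | ih with suc (suc c) ≟ 2 ^ bitlength (suc c)
  ...   | yes eq = *-monoʳ-≤ 2 (≤-reflexive (sym eq))
  ...   | no _   = ≤-trans ih (*-monoʳ-≤ 2 (n≤1+n (suc c)))

  records≤ : ∀ {n} m → n ≤ 2 ^ m → records n ≤ 2 * suc m
  records≤ {zero}  m _  = z≤n
  records≤ {suc n} m n≤ = *-monoʳ-≤ 2 (2^-cancel-≤ {bitlength (suc n)} {suc m} (≤-trans (2^bitlength≤ n) (*-monoʳ-≤ 2 n≤)))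

  floor-log : ∀ m → ∃[ l ] 2 ^ l ≤ suc m × suc m < 2 ^ suc l
  floor-log zero = 0 , ≤-refl , ≤-refl
  floor-log (suc m) with floor-log m
  ... | l , lo , hi with m≤n⇒m<n∨m≡n hi
  ...   | inj₁ lt = l , m≤n⇒m≤1+n lo , lt
  ...   | inj₂ eq = suc l , ≤-reflexive (sym eq) , ≤-<-trans (≤-reflexive eq) (^-monoʳ-< 2 (s≤s (s≤s z≤n)) (n<1+n (suc l)))

  floor-sqrt : ∀ m → ∃[ s ] s * s ≤ m × m < suc s * suc s
  floor-sqrt zero = 0 , z≤n , ≤-refl
  floor-sqrt (suc m) with floor-sqrt m
  ... | s , lo , hi with m≤n⇒m<n∨m≡n hi
  ...   | inj₁ lt = s , m≤n⇒m≤1+n lo , lt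
  ...   | inj₂ eq = suc s , ≤-reflexive (sym eq) , ≤-<-trans (≤-reflexive eq) (*-mono-< (n<1+n (suc s)) (n<1+n (suc s)))

  -- With x the bound for j, the bracket in `density` is at most x + 2x + x. With the outer 2 this
  -- explains the 8, and every step multiplies the bound by 2 ^ (a + q).
  density≤ : ∀ n a q → 8 * records n ≤ 2 ^ q → ∀ j → density n (2 ^ a) j ≤ 2 ^ (suc (a * suc j) + q * j)
  density≤ n a q g≤ zero = ^-monoʳ-≤ 2 {1} {suc (a * 1) + q * 0} (s≤s z≤n)
  density≤ n a q g≤ (suc j) = begin
    y * (2 * ((2 + (2 * (y * y ^ j + y * y ^ j) + d)) * g))
      ≡⟨ cong (λ p → y * (2 * ((2 + (2 * (p + p) + d)) * g))) (^-*-assoc 2 a (suc j)) ⟩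
    y * (2 * ((2 + (2 * (p + p) + d)) * g))
      ≤⟨ *-monoʳ-≤ y (*-monoʳ-≤ 2 (*-monoˡ-≤ g (+-mono-≤ {2} (^-monoʳ-≤ 2 {1} {e} (s≤s z≤n))
           (+-mono-≤ {2 * (p + p)} {2 * x} (*-monoʳ-≤ 2 2p≤x) (density≤ n a q g≤ j))))) ⟩
    y * (2 * ((x + (2 * x + x)) * g))
      ≡⟨ rearrange y x g ⟩
    y * (8 * g * x)
      ≤⟨ *-monoʳ-≤ y (*-monoˡ-≤ x g≤) ⟩
    2 ^ a * (2 ^ q * 2 ^ e)
      ≡⟨ trans (cong (2 ^ a *_) (sym (^-distribˡ-+-* 2 q e))) (sym (^-distribˡ-+-* 2 a (q + e))) ⟩
    2 ^ (a + (q + e))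
      ≡⟨ cong (2 ^_) (exponents a q j) ⟩
    2 ^ (suc (a * suc (suc j)) + q * suc j) ∎
    where
    y = 2 ^ a
    g = records n
    d = density n y j
    p = 2 ^ (a * suc j)
    e = suc (a * suc j) + q * j
    x = 2 ^ e
    2p≤x : p + p ≤ x
    2p≤x = ≤-trans (≤-reflexive (cong (p +_) (sym (+-identityʳ p)))) (^-monoʳ-≤ 2 {suc (a * suc j)} {e} (m≤m+n _ _))
    rearrange : ∀ y x g → y * (2 * ((x + (2 * x + x)) * g)) ≡ y * (8 * g * x)
    rearrange = solve-∀
    exponents : ∀ a q j → a + (q + (suc (a * suc j) + q * j)) ≡ suc (a * suc (suc j)) + q * suc j
    exponents = solve-∀

  -- Integer versions of log n, log log n and the root of their product. The bound `2^L<n` is strict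
  -- because the cut of n is open.
  record Logs (n : ℕ) : Set where
    field
      L ℓ s   : ℕ
      2^L<n   : 2 ^ L < n
      n≤2^1+L : n ≤ 2 ^ suc L
      2^ℓ≤L   : 2 ^ ℓ ≤ L
      L<2^1+ℓ : L < 2 ^ suc ℓ
      s²≤Lℓ   : s * s ≤ L * ℓ
      Lℓ<     : L * ℓ < suc s * suc s

  logs : ∀ n → 3 ≤ n → Logs n
  logs (suc (suc n)) (s≤s (s≤s 1≤n)) with floor-log n
  ... | zero , lo , hi = contradiction hi (≤⇒≯ (s≤s 1≤n))
  ... | suc L , lo , hi with floor-log L
  ...   | ℓ , 2^ℓ≤ , <2^ with floor-sqrt (suc L * ℓ)
  ...     | s , s²≤ , <s² = record
    { L = suc L ; ℓ = ℓ ; s = s ; 2^L<n = s≤s lo ; n≤2^1+L = hi ; 2^ℓ≤L = 2^ℓ≤ ; L<2^1+ℓ = <2^ ; s²≤Lℓ = s²≤ ; Lℓ< = <s² }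

  m<2^m : ∀ m → m < 2 ^ m
  m<2^m zero    = ≤-refl
  m<2^m (suc m) = begin-strict
    suc m         ≤⟨ m<2^m m ⟩
    2 ^ m         <⟨ ^-monoʳ-< 2 (s≤s (s≤s z≤n)) (n<1+n m) ⟩
    2 ^ suc m ∎

  module Parameters {n : ℕ} (5≤n : 5 ≤ n) (logs : Logs n) where
    open Logs logs

    2≤L : 2 ≤ L
    2≤L = s≤s⁻¹ (2^-cancel-< (≤-trans 5≤n n≤2^1+L))

    1≤ℓ : 1 ≤ ℓ
    1≤ℓ = s≤s⁻¹ (2^-cancel-< (≤-<-trans 2≤L L<2^1+ℓ))

    ℓ≤s : ℓ ≤ s
    ℓ≤s = ≮⇒≥ λ s<ℓ → <-irrefl refl (begin-strict
      L * ℓ          <⟨ Lℓ< ⟩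
      suc s * suc s  ≤⟨ *-mono-≤ s<ℓ s<ℓ ⟩
      ℓ * ℓ          ≤⟨ *-monoˡ-≤ ℓ (≤-trans (<⇒≤ (m<2^m ℓ)) 2^ℓ≤L) ⟩
      L * ℓ ∎)

    1≤s : 1 ≤ s
    1≤s = ≤-trans 1≤ℓ ℓ≤s

    q w d j : ℕ
    -- Of the 6, three come from the factor 8, one from the factor 2 in `records` and two from
    -- rounding.
    q = ℓ + 6
    w = s + q

    instance
      w-nonZero : NonZero w
      w-nonZero = >-nonZero (≤-trans 1≤s (m≤m+n s q))

    -- Each step costs w in the exponent and d such costs fit below L. One pays for the base case,
    -- hence `pred`; if d = 0, then j = 0 and 5 ≤ n suffices.
    d = pred L / w
    j = pred d

    records-small : 8 * records n ≤ 2 ^ q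
    records-small = begin
      8 * records n              ≤⟨ *-monoʳ-≤ 8 (records≤ (suc L) n≤2^1+L) ⟩
      8 * (2 * suc (suc L))      ≤⟨ *-monoʳ-≤ 8 (*-monoʳ-≤ 2 (≤-trans (s≤s L<2^1+ℓ) (+-monoˡ-≤ (2 ^ suc ℓ) (1≤2^ (suc ℓ))))) ⟩
      8 * (2 * (2 ^ suc ℓ + 2 ^ suc ℓ)) ≡⟨ cong (λ x → 8 * (2 * (2 ^ suc ℓ + x))) (+-identityʳ (2 ^ suc ℓ)) ⟨
      8 * (2 * 2 ^ suc (suc ℓ))  ≡⟨ ^-distribˡ-+-* 2 3 (suc (suc (suc ℓ))) ⟨
      2 ^ (3 + (3 + ℓ))          ≡⟨ cong (2 ^_) (+-comm 6 ℓ) ⟩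
      2 ^ q ∎

    d*w≤ : d * w ≤ pred L
    d*w≤ = ≤-trans (m≤n+m _ _) (≤-reflexive (sym (m≡m%n+[m/n]*n (pred L) w)))

    L≤ : L ≤ (2 + j) * w
    L≤ = begin
      L                             ≡⟨ suc-pred L {{>-nonZero (≤-trans (s≤s z≤n) 2≤L)}} ⟨
      suc (pred L)                  ≡⟨ cong suc (m≡m%n+[m/n]*n (pred L) w) ⟩
      suc (pred L % w + d * w)      ≤⟨ +-mono-≤ (m%n<n (pred L) w) (*-monoˡ-≤ w (d≤ d)) ⟩
      w + suc j * w ∎
      where
      d≤ : ∀ d → d ≤ suc (pred d)
      d≤ zero    = z≤n
      d≤ (suc d) = ≤-refl

    sparse-enough : density n (2 ^ s) j < pred n
    sparse-enough = by-cases d refl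
      where
      by-cases : ∀ d′ → d ≡ d′ → density n (2 ^ s) j < pred n
      by-cases zero d≡0 rewrite d≡0 = <-≤-trans (s≤s (s≤s (s≤s z≤n))) (pred-mono-≤ 5≤n)
      by-cases (suc i) d≡1+i rewrite d≡1+i = begin-strict
        density n (2 ^ s) i                 ≤⟨ density≤ n s q records-small i ⟩
        2 ^ (suc (s * suc i) + q * i)       ≤⟨ ^-monoʳ-≤ 2 (begin
          suc (s * suc i) + q * i             ≤⟨ +-monoˡ-≤ _ (+-monoˡ-≤ (s * suc i) (≤-trans (s≤s z≤n) (m≤n+m 6 ℓ))) ⟩
          q + s * suc i + q * i               ≡⟨ rearrange q s i ⟩
          suc i * w                           ≡⟨ cong (_* w) d≡1+i ⟨
          d * w                               ≤⟨ d*w≤ ⟩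
          pred L ∎) ⟩
        2 ^ pred L                          <⟨ ^-monoʳ-< 2 (s≤s (s≤s z≤n)) (≤-reflexive (suc-pred L {{>-nonZero (≤-trans (s≤s z≤n) 2≤L)}})) ⟩
        2 ^ L                               ≤⟨ pred-mono-≤ 2^L<n ⟩
        pred n ∎
        where
        rearrange : ∀ q s i → q + s * suc i + q * i ≡ suc i * (s + q)
        rearrange = solve-∀

    -- From j s ≤ L follows j s ℓ ≤ (1 + s)² ≤ 4 s², and s cancels.
    j*ℓ≤ : j * ℓ ≤ 4 * s
    j*ℓ≤ = *-cancelʳ-≤ (j * ℓ) (4 * s) s {{>-nonZero 1≤s}} (begin
      j * ℓ * s       ≡⟨ trans (*-assoc j ℓ s) (trans (cong (j *_) (*-comm ℓ s)) (sym (*-assoc j s ℓ))) ⟩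
      j * s * ℓ       ≤⟨ *-monoˡ-≤ ℓ (≤-trans (*-mono-≤ (pred[n]≤n {d}) (m≤m+n s q)) (≤-trans d*w≤ (pred[n]≤n {L}))) ⟩
      L * ℓ           ≤⟨ <⇒≤ Lℓ< ⟩
      suc s * suc s   ≤⟨ *-mono-≤ (+-monoˡ-≤ s 1≤s) (+-monoˡ-≤ s 1≤s) ⟩
      (s + s) * (s + s) ≡⟨ rearrange s ⟩
      4 * s * s ∎)
      where
      rearrange : ∀ s → (s + s) * (s + s) ≡ 4 * s * s
      rearrange = solve-∀

    -- In the exponent the path attains s j. The loss 1 + 2s + 2ℓ + 12 + jℓ + 6j is at most (1 + 2 +
    -- 2 + 12 + 4 + 24) s, by 1 ≤ ℓ ≤ s and `j*ℓ≤`.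
    nearly-linear : n ≤ (2 ^ s) ^ j * 2 ^ (45 * s)
    nearly-linear = begin
      n                            ≤⟨ n≤2^1+L ⟩
      2 ^ suc L                    ≤⟨ ^-monoʳ-≤ 2 exponents ⟩
      2 ^ (s * j + 45 * s)         ≡⟨ ^-distribˡ-+-* 2 (s * j) (45 * s) ⟩
      2 ^ (s * j) * 2 ^ (45 * s)   ≡⟨ cong (_* 2 ^ (45 * s)) (^-*-assoc 2 s j) ⟨
      (2 ^ s) ^ j * 2 ^ (45 * s) ∎
      where
      split : ∀ s ℓ j → suc ((2 + j) * (s + (ℓ + 6))) ≡ s * j + (1 + 2 * s + 2 * ℓ + 12) + (j * ℓ + 6 * (j * 1))
      split = solve-∀
      gather : ∀ s → s * 1 + 2 * s + 2 * s + 12 * s + (4 * s + 6 * (4 * s)) ≡ 45 * s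
      gather = solve-∀
      exponents : suc L ≤ s * j + 45 * s
      exponents = begin
        suc L                                ≤⟨ s≤s L≤ ⟩
        suc ((2 + j) * (s + (ℓ + 6)))        ≡⟨ split s ℓ j ⟩
        s * j + (1 + 2 * s + 2 * ℓ + 12) + (j * ℓ + 6 * (j * 1))
          ≡⟨ +-assoc (s * j) _ _ ⟩
        s * j + ((1 + 2 * s + 2 * ℓ + 12) + (j * ℓ + 6 * (j * 1)))
          ≤⟨ +-monoʳ-≤ (s * j) (+-mono-≤
               (+-mono-≤ (+-mono-≤ (+-monoˡ-≤ (2 * s) {1} {s * 1} (≤-trans 1≤s (≤-reflexive (sym (*-identityʳ s))))) (*-monoʳ-≤ 2 ℓ≤s)) (*-monoʳ-≤ 12 1≤s))
               (+-mono-≤ j*ℓ≤ (*-monoʳ-≤ 6 (≤-trans (*-monoʳ-≤ j 1≤ℓ) j*ℓ≤)))) ⟩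
        s * j + (s * 1 + 2 * s + 2 * s + 12 * s + (4 * s + 6 * (4 * s)))
          ≡⟨ cong (s * j +_) (gather s) ⟩
        s * j + 45 * s ∎

  [1+m]²<2^m : ∀ m → suc (6 + m) * suc (6 + m) < 2 ^ (6 + m)
  [1+m]²<2^m zero    = m<m+n 49 {15} (s≤s z≤n)
  [1+m]²<2^m (suc m) = begin-strict
    (8 + m) * (8 + m)           ≤⟨ m≤m+n _ (34 + 12 * m + m * m) ⟩
    (8 + m) * (8 + m) + (34 + 12 * m + m * m) ≡⟨ expand m ⟩
    2 * ((7 + m) * (7 + m))     <⟨ *-monoʳ-< 2 ([1+m]²<2^m m) ⟩
    2 * 2 ^ (6 + m) ∎
    where
    expand : ∀ m → (8 + m) * (8 + m) + (34 + 12 * m + m * m) ≡ 2 * ((7 + m) * (7 + m))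
    expand = solve-∀

  -- Forces 6 + 2x ≤ ℓ: the 6 for `[1+m]²<2^m`, the 2x to let `suc ℓ` absorb the factor 2x.
  threshold : ℕ → ℕ
  threshold x = 2 ^ (2 ^ (6 + 2 * x))

  -- An integer form of log n · log log n = o((log n)²): 2x (1 + ℓ) ≤ (1 + ℓ)² < 2 ^ ℓ ≤ L, where
  -- the 2 comes from 1 + L ≤ 2L.
  log-loglog<log² : ∀ x {n} → threshold x < n → (logs : Logs n) → let open Logs logs in
                    x * (suc L * suc ℓ) < L * L
  log-loglog<log² x {n} big logs = begin-strict
    x * (suc L * suc ℓ)      ≤⟨ *-monoʳ-≤ x (*-monoˡ-≤ (suc ℓ) (+-monoˡ-≤ L 1≤L)) ⟩
    x * ((L + L) * suc ℓ)    ≡⟨ rearrange x L ℓ ⟩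
    L * (2 * x * suc ℓ)      <⟨ *-monoʳ-< L {{>-nonZero 1≤L}} (≤-trans small 2^ℓ≤L) ⟩
    L * L ∎
    where
    open Logs logs
    rearrange : ∀ x L ℓ → x * ((L + L) * suc ℓ) ≡ L * (2 * x * suc ℓ)
    rearrange = solve-∀
    1≤L : 1 ≤ L
    1≤L = ≤-trans (1≤2^ ℓ) 2^ℓ≤L
    ℓ-large : 6 + 2 * x ≤ ℓ
    ℓ-large = s≤s⁻¹ (2^-cancel-< (≤-<-trans (s≤s⁻¹ (2^-cancel-< (<-≤-trans big n≤2^1+L))) L<2^1+ℓ))
    small : 2 * x * suc ℓ < 2 ^ ℓ
    small = begin-strict
      2 * x * suc ℓ   ≤⟨ *-monoˡ-≤ (suc ℓ) (≤-trans (m≤n+m (2 * x) 6) (m≤n⇒m≤1+n ℓ-large)) ⟩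
      suc ℓ * suc ℓ   <⟨ subst (λ m → suc m * suc m < 2 ^ m) (m+[n∸m]≡n (≤-trans (m≤m+n 6 (2 * x)) ℓ-large)) ([1+m]²<2^m (ℓ ∸ 6)) ⟩
      2 ^ ℓ ∎

-- Comparison with the real bounds

open import Defs
open import Data.Nat.Base using (ℕ; _≥_)
open import Data.Rational.Base using (ℚ; 0ℚ; _<_)
open import Data.Integer.Base as ℤ using (+_; -[1+_])
import Data.Integer.Properties as ℤ
open import Data.Nat.Base as ℕ using (suc; zero; z≤n; s≤s)
import Data.Nat.Coprimality as Coprime
import Data.Nat.Properties as ℕ
open import Data.Rational.Base using (mkℚ; 1ℚ; _/_; _*_; _≤_; *≤*; *<*; nonNegative)
open import Data.Rational.Properties
import Data.Rational.Unnormalised.Base as ℚᵘ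
import Data.Rational.Unnormalised.Properties as ℚᵘ
open import Relation.Unary using (_∈_)
open Combinatorics using (Logs; logs; module Parameters; 1≤2^; 2^-cancel-≤; threshold; log-loglog<log²; long-monotone-path)

<⇒≱ : ∀ {p q} → p < q → ¬ q ≤ p
<⇒≱ p<q q≤p = <-irrefl refl (<-≤-trans p<q q≤p)

ι : ℕ → ℚ
ι m = + m / 1

-- The division normalises by a gcd that does not compute for a variable m; in this form numerator
-- and denominator can be read off.
ι-normal : ∀ m → ι m ≡ mkℚ (+ m) 0 (Coprime.sym (Coprime.1-coprimeTo m))
ι-normal m = normalize-coprime _

ι-mono-≤ : ∀ {m n} → m ℕ.≤ n → ι m ≤ ι n
ι-mono-≤ {m} {n} m≤n = subst₂ _≤_ (sym (ι-normal m)) (sym (ι-normal n)) (*≤* (ℤ.*-monoʳ-≤-nonNeg (+ 1) (ℤ.+≤+ m≤n)))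

ι-mono-< : ∀ {m n} → m ℕ.< n → ι m < ι n
ι-mono-< {m} {n} m<n = subst₂ _<_ (sym (ι-normal m)) (sym (ι-normal n)) (*<* (ℤ.*-monoʳ-<-pos (+ 1) (ℤ.+<+ m<n)))

ι-cancel-≤ : ∀ {m n} → ι m ≤ ι n → m ℕ.≤ n
ι-cancel-≤ ιm≤ιn = ℕ.≮⇒≥ λ n<m → <⇒≱ (ι-mono-< n<m) ιm≤ιn

ι-* : ∀ m n → ι (m ℕ.* n) ≡ ι m * ι n
ι-* m n = trans (cong (_/ 1) (ℤ.pos-* m n)) (sym (cong₂ _*_ (ι-normal m) (ι-normal n)))

ι-^ : ∀ m k → ι m ^ℚ k ≡ ι (m ℕ.^ k)
ι-^ m zero    = refl
ι-^ m (suc k) = trans (cong (ι m *_) (ι-^ m k)) (sym (ι-* m (m ℕ.^ k)))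

ι-nonNeg : ∀ m → 0ℚ ≤ ι m
ι-nonNeg m = ι-mono-≤ {0} {m} z≤n

*-mono-≤-nonNeg : ∀ {p q r s} → 0ℚ ≤ p → p ≤ q → 0ℚ ≤ r → r ≤ s → p * r ≤ q * s
*-mono-≤-nonNeg {p} {q} {r} {s} 0≤p p≤q 0≤r r≤s = ≤-trans
  (*-monoʳ-≤-nonNeg r {{nonNegative 0≤r}} p≤q) (*-monoˡ-≤-nonNeg q {{nonNegative (≤-trans 0≤p p≤q)}} r≤s)

*-nonNeg : ∀ {p q} → 0ℚ ≤ p → 0ℚ ≤ q → 0ℚ ≤ p * q
*-nonNeg 0≤p 0≤q = *-mono-≤-nonNeg {0ℚ} {r = 0ℚ} ≤-refl 0≤p ≤-refl 0≤q

*-square : ∀ r q → (r * q) * (r * q) ≡ (r * r) * (q * q)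
*-square r q = trans (*-assoc r q (r * q)) (trans (cong (r *_) (trans (sym (*-assoc q r q))
  (trans (cong (_* q) (*-comm q r)) (*-assoc r q q)))) (sym (*-assoc r r (q * q))))

^ℚ-nonNeg : ∀ {p} → 0ℚ ≤ p → ∀ k → 0ℚ ≤ p ^ℚ k
^ℚ-nonNeg 0≤p zero    = ι-nonNeg 1
^ℚ-nonNeg 0≤p (suc k) = *-nonNeg 0≤p (^ℚ-nonNeg 0≤p k)

^ℚ-mono : ∀ {p q} → 0ℚ ≤ p → p ≤ q → ∀ k → p ^ℚ k ≤ q ^ℚ k
^ℚ-mono 0≤p p≤q zero    = ≤-refl
^ℚ-mono 0≤p p≤q (suc k) = *-mono-≤-nonNeg 0≤p p≤q (^ℚ-nonNeg 0≤p k) (^ℚ-mono 0≤p p≤q k)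

log₂-lower : ∀ (x : Real) m a → 1 ℕ.≤ m → 2 ℕ.^ a ℕ.≤ m → ι m ∈ x → ι a ∈ log₂ x
log₂-lower x m a 1≤m 2^a≤m m∈x = subst (_∈ log₂ x) (sym (ι-normal a)) (ι m , (ι-mono-< 1≤m , m∈x) , (begin
  ι 2 ^ℚ a        ≡⟨ ι-^ 2 a ⟩
  ι (2 ℕ.^ a)     ≤⟨ ι-mono-≤ 2^a≤m ⟩
  ι m             ≡⟨ *-identityʳ (ι m) ⟨
  ι m * 1ℚ        ∎))
  where open ≤-Reasoning

-- For q = b / d a witness r gives 2 ^ b ≤ r ^ d ≤ 2 ^ (a d), hence b ≤ a d.
log₂-upper : ∀ (x : Real) a {q} → (∀ {r} → 0ℚ < r → r ∈ x → r ≤ ι (2 ℕ.^ a)) → 0ℚ ≤ q → q ∈ log₂ x → q ≤ ι a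
log₂-upper x a {mkℚ -[1+ _ ] _ _} x≤ (*≤* ()) _
log₂-upper x a {mkℚ (+ b) d-1 c} x≤ _ (r , (0<r , r∈x) , le) = subst (mkℚ (+ b) d-1 c ≤_) (sym (ι-normal a))
  (*≤* (subst₂ ℤ._≤_ (sym (ℤ.*-identityʳ (+ b))) (ℤ.pos-* a (suc d-1)) (ℤ.+≤+ b≤)))
  where
  open ≤-Reasoning
  b≤ : b ℕ.≤ a ℕ.* suc d-1
  b≤ = 2^-cancel-≤ (ι-cancel-≤ (begin
    ι (2 ℕ.^ b)                ≡⟨ ι-^ 2 b ⟨
    ι 2 ^ℚ b                   ≤⟨ le ⟩
    r ^ℚ suc d-1               ≤⟨ ^ℚ-mono (<⇒≤ 0<r) (x≤ 0<r r∈x) (suc d-1) ⟩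
    ι (2 ℕ.^ a) ^ℚ suc d-1     ≡⟨ ι-^ (2 ℕ.^ a) (suc d-1) ⟩
    ι ((2 ℕ.^ a) ℕ.^ suc d-1)  ≡⟨ cong ι (ℕ.^-*-assoc 2 a (suc d-1)) ⟩
    ι (2 ℕ.^ (a ℕ.* suc d-1)) ∎))

exp₂-lower : ∀ (x : Real) a → ι a ∈ x → ι (2 ℕ.^ a) ∈ exp₂ x
exp₂-lower x a a∈x = inj₂ (mkℚ (+ a) 0 _ , subst x (ι-normal a) a∈x ,
  ≤-reflexive (trans (*-identityʳ (ι (2 ℕ.^ a))) (sym (ι-^ 2 a))))

-- Estimates for the cuts in the theorem

module _ {n : ℕ} (logs : Logs n) where
  open Logs logs

  L∈log : ι L ∈ log₂ (natural n)
  L∈log = log₂-lower (natural n) (2 ℕ.^ L) L (1≤2^ L) ℕ.≤-refl (ι-mono-< 2^L<n)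

  ℓ∈loglog : ι ℓ ∈ log₂ (log₂ (natural n))
  ℓ∈loglog = log₂-lower (log₂ (natural n)) L ℓ (ℕ.≤-trans (1≤2^ ℓ) 2^ℓ≤L) 2^ℓ≤L L∈log

  log≤ : ∀ {q} → 0ℚ ≤ q → q ∈ log₂ (natural n) → q ≤ ι (suc L)
  log≤ = log₂-upper (natural n) (suc L) (λ _ r<n → ≤-trans (<⇒≤ r<n) (ι-mono-≤ n≤2^1+L))

  loglog≤ : ∀ {q} → 0ℚ ≤ q → q ∈ log₂ (log₂ (natural n)) → q ≤ ι (suc ℓ)
  loglog≤ = log₂-upper (log₂ (natural n)) (suc ℓ) (λ 0<r r∈ → ≤-trans (log≤ (<⇒≤ 0<r) r∈) (ι-mono-≤ L<2^1+ℓ))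

  s∈√ : ι s ∈ √ (log₂ (natural n) · log₂ (log₂ (natural n)))
  s∈√ = inj₂ (inj₂ (ι L , ι ℓ , (ι-nonNeg L , L∈log) , (ι-nonNeg ℓ , ℓ∈loglog) ,
    subst₂ _≤_ (ι-* s s) (ι-* L ℓ) (ι-mono-≤ s²≤Lℓ)))

  -- The product of cuts needs a factor strictly below the constant, so c is used below `suc c`.
  exponent-lower : ∀ c → ι (c ℕ.* s) ∈ exponent (ι (suc c)) n
  exponent-lower c = inj₂ (ι c , ι s , (ι-nonNeg c , ι-mono-< (ℕ.n<1+n c)) , (ι-nonNeg s , s∈√) , ≤-reflexive (ι-* c s))

  exponent-upper : ∀ {C p} → 0ℚ ≤ p → p ∈ exponent (ι C) n → p * p ≤ ι (C ℕ.* C) * ι (suc L ℕ.* suc ℓ)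
  exponent-upper 0≤p (inj₁ p<0) = contradiction 0≤p (<⇒≱ p<0)
  exponent-upper 0≤p (inj₂ (r , q , _ , (0≤q , inj₁ q<0) , _)) = contradiction 0≤q (<⇒≱ q<0)
  exponent-upper 0≤p (inj₂ (r , q , _ , (0≤q , inj₂ (inj₁ q²<0)) , _)) = contradiction (*-nonNeg 0≤q 0≤q) (<⇒≱ q²<0)
  exponent-upper {C} {p} 0≤p (inj₂ (r , q , (0≤r , r<C) , (0≤q , inj₂ (inj₂ (a , b , (0≤a , a∈) , (0≤b , b∈) , q²≤))) , p≤)) = begin
    p * p                    ≤⟨ *-mono-≤-nonNeg 0≤p p≤ 0≤p p≤ ⟩
    (r * q) * (r * q)        ≡⟨ *-square r q ⟩
    (r * r) * (q * q)        ≤⟨ *-mono-≤-nonNeg (*-nonNeg 0≤r 0≤r) (*-mono-≤-nonNeg 0≤r (<⇒≤ r<C) 0≤r (<⇒≤ r<C)) (*-nonNeg 0≤q 0≤q)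
                                  (≤-trans q²≤ (*-mono-≤-nonNeg 0≤a (log≤ 0≤a a∈) 0≤b (loglog≤ 0≤b b∈))) ⟩
    (ι C * ι C) * (ι (suc L) * ι (suc ℓ)) ≡⟨ cong₂ _*_ (ι-* C C) (ι-* (suc L) (suc ℓ)) ⟨
    ι (C ℕ.* C) * ι (suc L ℕ.* suc ℓ) ∎
    where
    open ≤-Reasoning

  -- A member q ≥ k of the quotient, with witness p, would give k 2 ^ t ≤ q 2 ^ t ≤ p < n ≤ k 2 ^ t.
  bound-upper : ∀ C t k → ι t ∈ exponent C n → n ℕ.≤ k ℕ.* 2 ℕ.^ t → bound C n ≤ᵣ natural k
  bound-upper C t k t∈ n≤ (inj₁ q<0) = <-≤-trans q<0 (ι-nonNeg k)
  bound-upper C t k t∈ n≤ {q} (inj₂ (p , p<n , q·≤p)) = ≰⇒> λ k≤q → <⇒≱ p<n (begin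
    ι n                    ≤⟨ ι-mono-≤ n≤ ⟩
    ι (k ℕ.* 2 ℕ.^ t)      ≡⟨ ι-* k (2 ℕ.^ t) ⟩
    ι k * ι (2 ℕ.^ t)      ≤⟨ *-monoʳ-≤-nonNeg (ι (2 ℕ.^ t)) {{nonNegative (ι-nonNeg (2 ℕ.^ t))}} k≤q ⟩
    q * ι (2 ℕ.^ t)        ≤⟨ q·≤p _ (exp₂-lower (exponent C n) t t∈) ⟩
    p ∎)
    where open ≤-Reasoning

  -- If ε ≤ q, then 1 ≤ M q, and q L ≤ p yields L ≤ M p. Squaring and `exponent-upper` give L² ≤ M²
  -- C² (1 + L)(1 + ℓ), against `large`.
  ratio-small : ∀ C M {ε} → 0ℚ < ε → ι 1 ≤ ι M * ε → (M ℕ.* M ℕ.* (C ℕ.* C)) ℕ.* (suc L ℕ.* suc ℓ) ℕ.< L ℕ.* L →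
                exponent (ι C) n ÷ log₂ (natural n) ≤ᵣ rational ε
  ratio-small C M 0<ε 1≤Mε large (inj₁ q<0) = <-trans q<0 0<ε
  ratio-small C M {ε} 0<ε 1≤Mε large {q} (inj₂ (p , p∈ , q·≤p)) = ≰⇒> λ ε≤q →
    let
      L≤Mp : ι L ≤ ι M * p
      L≤Mp = begin
        ι L               ≡⟨ *-identityˡ (ι L) ⟨
        ι 1 * ι L         ≤⟨ *-mono-≤-nonNeg (ι-nonNeg 1) (≤-trans 1≤Mε (*-monoˡ-≤-nonNeg (ι M) {{nonNegative (ι-nonNeg M)}} ε≤q)) (ι-nonNeg L) ≤-refl ⟩
        ι M * q * ι L     ≡⟨ *-assoc (ι M) q (ι L) ⟩
        ι M * (q * ι L)   ≤⟨ *-monoˡ-≤-nonNeg (ι M) {{nonNegative (ι-nonNeg M)}} (q·≤p (ι L) L∈log) ⟩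
        ι M * p ∎
      0≤p : 0ℚ ≤ p
      0≤p = ≤-trans (*-nonNeg (≤-trans (<⇒≤ 0<ε) ε≤q) (ι-nonNeg L)) (q·≤p (ι L) L∈log)
    in <⇒≱ (ι-mono-< large) (begin
      ι (L ℕ.* L)                 ≡⟨ ι-* L L ⟩
      ι L * ι L                   ≤⟨ *-mono-≤-nonNeg (ι-nonNeg L) L≤Mp (ι-nonNeg L) L≤Mp ⟩
      (ι M * p) * (ι M * p)       ≡⟨ *-square (ι M) p ⟩
      (ι M * ι M) * (p * p)       ≤⟨ *-mono-≤-nonNeg (*-nonNeg (ι-nonNeg M) (ι-nonNeg M)) (≤-reflexive (sym (ι-* M M))) (*-nonNeg 0≤p 0≤p) (exponent-upper {C} 0≤p p∈) ⟩
      ι (M ℕ.* M) * (ι (C ℕ.* C) * ι (suc L ℕ.* suc ℓ)) ≡⟨ *-assoc (ι (M ℕ.* M)) (ι (C ℕ.* C)) _ ⟨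
      ι (M ℕ.* M) * ι (C ℕ.* C) * ι (suc L ℕ.* suc ℓ)   ≡⟨ cong (_* ι (suc L ℕ.* suc ℓ)) (ι-* (M ℕ.* M) (C ℕ.* C)) ⟨
      ι (M ℕ.* M ℕ.* (C ℕ.* C)) * ι (suc L ℕ.* suc ℓ)   ≡⟨ ι-* (M ℕ.* M ℕ.* (C ℕ.* C)) (suc L ℕ.* suc ℓ) ⟨
      ι (M ℕ.* M ℕ.* (C ℕ.* C) ℕ.* (suc L ℕ.* suc ℓ)) ∎)
    where
    open ≤-Reasoning

archimedean : ∀ {ε} → 0ℚ < ε → ∃[ M ] ι 1 ≤ ι M * ε
archimedean {mkℚ (+ zero)  _ _} (*<* (ℤ.+<+ ()))
archimedean {mkℚ -[1+ _ ]  _ _} (*<* ())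
archimedean {ε@(mkℚ (+ suc a) d-1 c)} _ = M , subst (λ m → ι 1 ≤ m * ε) (sym (ι-normal M))
  (toℚᵘ-cancel-≤ (ℚᵘ.≤-respʳ-≃ (ℚᵘ.≃-sym (toℚᵘ-homo-* (mkℚ (+ M) 0 (Coprime.sym (Coprime.1-coprimeTo M))) ε)) (ℚᵘ.*≤* (ℤ.+≤+ (begin
    1 ℕ.* (1 ℕ.* M)     ≡⟨ trans (ℕ.*-identityˡ _) (ℕ.*-identityˡ M) ⟩
    M                     ≤⟨ ℕ.m≤m*n M (suc a) ⟩
    M ℕ.* suc a           ≡⟨ ℕ.*-identityʳ _ ⟨
    M ℕ.* suc a ℕ.* 1 ∎)))))
  where
  open ℕ.≤-Reasoning
  -- The denominator of ε; its product with ε is the positive numerator.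
  M = suc d-1

theorem1p1 : ∃ λ (C : ℚ) → 0ℚ < C ×
    (∃ λ (N : ℕ) → ∀ n → n ≥ N →
    ((o : EdgeOrdering (K n)) →
    ∃ λ (k : ℕ) → HasMonotonePath (K n) o k × bound C n ≤ᵣ natural k) ×
    (∀ (a : ℕ) → IsAltitude (K n) a → bound C n ≤ᵣ natural a)) ×
    (∀ (ε : ℚ) → 0ℚ < ε → ∃ λ (N : ℕ) → ∀ n → n ≥ N →
    exponent C n ÷ log₂ (natural n) ≤ᵣ rational ε)
-- The 45 of `nearly-linear`, plus 1 to stay inside the open cut.
theorem1p1 = ι 46 , ι-mono-< {0} {46} (s≤s z≤n) , (5 , main) , small
  where
  main : ∀ n → n ≥ 5 → _
  -- The length k depends on n alone, so all edge-orderings force it and the altitude is at least k.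
  main n 5≤n = (λ o → k , forced o , λ {q} → bound≤k {q}) , λ a (_ , greatest) q∈ → <-≤-trans (bound≤k q∈) (ι-mono-≤ (greatest k forced))
    where
    lg = logs n (ℕ.≤-trans (s≤s (s≤s (s≤s z≤n))) 5≤n)
    open Logs lg using (s)
    open Parameters 5≤n lg using (j; sparse-enough; nearly-linear)
    k = (2 ℕ.^ s) ℕ.^ j
    forced : (o : EdgeOrdering (K n)) → HasMonotonePath (K n) o k
    forced o = long-monotone-path o (2 ℕ.^ s) {{ℕ.>-nonZero (1≤2^ s)}} j sparse-enough
    bound≤k : bound (ι 46) n ≤ᵣ natural k
    bound≤k {q} = bound-upper lg (ι 46) (45 ℕ.* s) k (exponent-lower lg 45) nearly-linear {q}
  small : ∀ ε → 0ℚ < ε → _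
  small ε 0<ε = let M , 1≤Mε = archimedean 0<ε ; x = M ℕ.* M ℕ.* (46 ℕ.* 46) in
    5 ℕ.+ threshold x , λ n n≥ {q} → let lg = logs n (ℕ.≤-trans (ℕ.≤-trans (s≤s (s≤s (s≤s z≤n))) (ℕ.m≤m+n 5 (threshold x))) n≥) in
      ratio-small lg 46 M 0<ε 1≤Mε (log-loglog<log² x (ℕ.≤-trans (s≤s (ℕ.m≤n+m (threshold x) 4)) n≥) lg) {q}
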